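{- Let $L$ be a metric signature, let $(M_i)_{i\in I}$ be a family of $L$-structures and $F$ a filter on $I$. If the Boolean algebra $\{0,1\}^F$ is atomless, then $M_F=\prod_iM_i/F\models\mathrm{SCP}$. In particular, this holds when $F$ is the Fréchet filter on $\omega$ (the filter of cofinite subsets of $\omega$).
   Context: Continuous first-order logic. The domains of (metric) $L$-structures are nonempty complete bounded metric spaces; predicates are bounded uniformly continuous real-valued maps, with bounds and moduli of uniform continuity prescribed by the signature. Formulas are built from atomic formulas (predicates, including the metric $d$, applied to terms) using continuous connectives $\mathbb R^n\to\mathbb R$ and the quantifiers $\sup,\inf$; formulas are $\mathbb R$-valued. A unary connective is a continuous map $\mathbb R\to\mathbb R$. A theory is a set of conditions such as $\varphi\le r$, with $\varphi$ a sentence and $r\in\mathbb R$. All filters are proper filters on nonempty sets. For a bounded family of reals, $\limsup_{i\to F}u_i=\inf_{J\in F}\sup_{i\in J}u_i$. Reduced products: on $\prod_i M_i$ let $d_F(a,b)=\limsup_{i\to F}d^{M_i}(a_i,b_i)$. The reduced product $M_F=\prod_i M_i/F$ has as domain the quotient of $\prod_iM_i$ by $d_F(a,b)=0$ (a complete bounded metric space); $a_F$ denotes the image of $a$; constants and functions are interpreted coordinatewise, and $p^{M_F}(a_F)=\limsup_{i\to F}p^{M_i}(a_i)$ for predicate symbols $p$. $\{0,1\}^F$ is the (classical) reduced power of the two-element Boolean algebra by $F$, i.e. the power set algebra of $I$ modulo the relation identifying $X,Y$ when they agree on a set in $F$. Palyutin formulas: the smallest set of formulas such that (1) every atomic formula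 is Palyutin; (2) if $\varphi$ is Palyutin and $C$ is a nondecreasing unary connective, then $C\varphi$ is Palyutin; (3) if $\varphi,\psi$ are Palyutin, so is $\max(\varphi,\psi)$; (4) if $\varphi$ is Palyutin and $x$ is a variable, $\inf_x\varphi$ and $\sup_x\varphi$ are Palyutin; (5) if $\varphi,\psi$ are Palyutin, $D$ is a nonincreasing unary connective with (necessarily unique) fixed point $\Delta$, and $x$ is a variable, then $\max(\inf_x\varphi,\ \sup_x\min(D\varphi,\Delta,\psi))$ is Palyutin. $\mathrm{SCP}$ is the theory consisting of the conditions \[\sup_y\Big(\inf_x\max(\varphi,D_1\psi_1,\dots,D_n\psi_n)-\max_{1\le j\le n}\inf_x\max(\varphi,D_j\psi_j)\Big)\le 0\] for all $n\ge2$, all Palyutin formulas $\varphi(x,y),\psi_1(x,y),\dots,\psi_n(x,y)$ ($x,y$ tuples of variables) and all nonincreasing unary connectives $D_1,\dots,D_n$. -}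

module Defs where

open import Level using (Level; 0ℓ; Setω) renaming (suc to lsuc; _⊔_ to _⊔ˡ_)
open import Algebra.Lattice.Bundles using (BooleanAlgebra)
open import Algebra.Lattice.Structures.Biased using (isBooleanAlgebraʳ; isDistributiveLatticeʳʲᵐ)
import Algebra.Lattice.Properties.Lattice as LatticeProperties
open import Axiom.ExcludedMiddle using (ExcludedMiddle)
open import Data.Bool.Base as Bool using (Bool; true; false)
import Data.Bool.Properties as Bool
open import Data.Empty using (⊥-elim)
open import Data.Fin.Base using (Fin; zero; suc)
open import Data.Integer.Base as ℤ using (+_; -[1+_])
import Data.Integer.Properties as ℤ
open import Data.List.Base using (List; []; _∷_; _++_)
open import Data.List.Membership.Propositional using (_∈_)
open import Data.List.Membership.Propositional.Properties using (∈-++⁺ˡ; ∈-++⁺ʳ)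
import Data.List.Membership.DecPropositional as DecMembership
open import Data.List.Relation.Unary.Any using (here; there)
open import Data.Nat.Base as ℕ using (ℕ; zero; suc; 2+)
open import Data.Nat.ListAction using (sum)
import Data.Nat.Coprimality as Coprimality
import Data.Nat.Properties as ℕ
open import Data.Product.Base using (Σ; ∃; ∃₂; _×_; _,_; proj₁; proj₂)
open import Data.Rational.Base as ℚ using (ℚ; mkℚ; 0ℚ; 1ℚ; ½)
import Data.Rational.Properties as ℚ
open import Data.Rational.Solver using (module +-*-Solver)
import Data.Rational.Unnormalised.Base as ℚᵘ
import Data.Rational.Unnormalised.Properties as ℚᵘ
open import Data.Sum.Base using (_⊎_; inj₁; inj₂; [_,_]′)
open import Data.Vec.Functional using (Vector) renaming ([] to []ᵛ; _∷_ to _∷ᵛ_)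
open import Function.Base using (_∘_)
open import Relation.Binary.Bundles using (Poset)
open import Relation.Binary.PropositionalEquality using (_≡_; refl; sym; trans; cong; cong₂; subst; subst₂)
open import Relation.Nullary using (¬_; yes; no)
open import Relation.Unary using (Pred; _⊆_; _∩_; U; ∅) renaming (_∈_ to _∈ᴾ_; _∉_ to _∉ᴾ_)

private variable
  a b ℓ ι s f : Level

------------------------------------------------------------------------
-- The real numbers

-- Dedekind cuts of ℚ.  No multiplication of reals is needed below.
record ℝ : Set₁ where
  field
    lower upper : Pred ℚ 0ℓ
    lower-inhabited : ∃ lower
    upper-inhabited : ∃ upper
    lower-closed : ∀ {q r} → q ℚ.≤ r → lower r → lower q
    upper-closed : ∀ {q r} → q ℚ.≤ r → upper q → upper r
    lower-rounded : ∀ {q} → lower q → ∃ λ r → q ℚ.< r × lower r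
    upper-rounded : ∀ {r} → upper r → ∃ λ q → q ℚ.< r × upper q
    lower<upper : ∀ {q r} → lower q → upper r → q ℚ.< r
    located : ∀ {q r} → q ℚ.< r → lower q ⊎ upper r

open ℝ

infix 4 _≤_ _<_ _≈_

_≤_ : ℝ → ℝ → Set
x ≤ y = lower x ⊆ lower y

_<_ : ℝ → ℝ → Set
x < y = ∃ λ q → upper x q × lower y q

-- Equality of reals; all operations below are used up to _≈_.
_≈_ : ℝ → ℝ → Set
x ≈ y = x ≤ y × y ≤ x

module Rat where
  open +-*-Solver

  fromℕ : ℕ → ℚ
  fromℕ n = mkℚ (+ n) 0 (Coprimality.sym (Coprimality.1-coprimeTo n))

  half : ℚ → ℚ
  half p = ½ ℚ.* p

  abstract
    fromℕ-suc : ∀ n → fromℕ (suc n) ≡ 1ℚ ℚ.+ fromℕ n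
    fromℕ-suc n = ℚ.toℚᵘ-injective
      (ℚᵘ.≃-trans (ℚᵘ.*≡* eq) (ℚᵘ.≃-sym (ℚ.toℚᵘ-homo-+ 1ℚ (fromℕ n))))
      where
      eq : (+ suc n) ℤ.* (+ 1) ≡ ((+ 1) ℤ.* (+ 1) ℤ.+ (+ n) ℤ.* (+ 1)) ℤ.* (+ 1)
      eq = cong (ℤ._* (+ 1)) (cong (λ t → (+ 1) ℤ.+ t) (sym (ℤ.*-identityʳ (+ n))))

    <-fromℕ : ∀ p → ∃ λ n → p ℚ.< fromℕ n
    <-fromℕ (mkℚ (+ m) d c) = suc m , ℚ.*<*
      (subst₂ ℤ._<_ (sym (ℤ.*-identityʳ (+ m))) (ℤ.pos-* (suc m) (suc d))
        (ℤ.+<+ (ℕ.m≤m*n (suc m) (suc d))))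
    <-fromℕ p@(mkℚ -[1+ m ] d c) = 0 , ℚ.negative⁻¹ p

    archimedean : ∀ p {δ} → 0ℚ ℚ.< δ → ∃ λ n → p ℚ.< fromℕ n ℚ.* δ
    archimedean p {δ} 0<δ =
      let n , lt = <-fromℕ (p ℚ.* ℚ.1/ δ)
      in  n , ℚ.<-respˡ-≡ eq (ℚ.*-monoˡ-<-pos δ lt)
      where
      instance
        δ⁺ : ℚ.Positive δ
        δ⁺ = ℚ.positive 0<δ
        δ≢0 : ℚ.NonZero δ
        δ≢0 = ℚ.pos⇒nonZero δ
      eq : p ℚ.* ℚ.1/ δ ℚ.* δ ≡ p
      eq = trans (ℚ.*-assoc p _ δ)
             (trans (cong (p ℚ.*_) (ℚ.*-inverseˡ δ)) (ℚ.*-identityʳ p))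

    neg-neg : ∀ p → ℚ.- (ℚ.- p) ≡ p
    neg-neg = solve 1 (λ p → :- (:- p) := p) refl

    <⇒0<- : ∀ {p q} → p ℚ.< q → 0ℚ ℚ.< q ℚ.- p
    <⇒0<- {p} {q} p<q = ℚ.<-respˡ-≡ (ℚ.+-inverseʳ p) (ℚ.+-monoˡ-< (ℚ.- p) p<q)

    half+half : ∀ p → half p ℚ.+ half p ≡ p
    half+half = solve 1 (λ p → con ½ :* p :+ con ½ :* p := p) refl

    0<half : ∀ {p} → 0ℚ ℚ.< p → 0ℚ ℚ.< half p
    0<half = ℚ.*-monoʳ-<-pos ½

    p<p+ε : ∀ p {ε} → 0ℚ ℚ.< ε → p ℚ.< p ℚ.+ ε
    p<p+ε p 0<ε = ℚ.<-respˡ-≡ (ℚ.+-identityʳ p) (ℚ.+-monoʳ-< p 0<ε)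

    half<id : ∀ {p} → 0ℚ ℚ.< p → half p ℚ.< p
    half<id {p} 0<p = ℚ.<-respʳ-≡ (half+half p) (p<p+ε (half p) (0<half 0<p))

    p-1<p : ∀ p → p ℚ.- 1ℚ ℚ.< p
    p-1<p p = ℚ.<-respʳ-≡ (ℚ.+-identityʳ p)
      (ℚ.+-monoʳ-< p (ℚ.negative⁻¹ (ℚ.- 1ℚ)))

    p<p+1 : ∀ p → p ℚ.< p ℚ.+ 1ℚ
    p<p+1 p = p<p+ε p (ℚ.positive⁻¹ 1ℚ)

    p+[q-p] : ∀ p q → p ℚ.+ (q ℚ.- p) ≡ q
    p+[q-p] = solve 2 (λ p q → p :+ (q :- p) := q) refl

    gap : ∀ {q r c d} → q ℚ.< r → d ℚ.≤ c ℚ.+ half (r ℚ.- q) → q ℚ.- c ℚ.< r ℚ.- d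
    gap {q} {r} {c} {d} q<r d≤ = subst₂ ℚ._<_
      (solve 3 (λ q c d → d :+ (q :- c :- d) := q :- c) refl q c d)
      (solve 4 (λ q c d r → c :+ (r :- q) :+ (q :- c :- d) := r :- d) refl q c d r)
      (ℚ.+-monoˡ-< (q ℚ.- c ℚ.- d) (ℚ.≤-<-trans d≤ (ℚ.+-monoʳ-< c (half<id (<⇒0<- q<r)))))

    ⊔-elim : (P : Pred ℚ 0ℓ) → ∀ p q → P p → P q → P (p ℚ.⊔ q)
    ⊔-elim P p q Pp Pq with ℚ.⊔-sel p q
    ... | inj₁ eq = subst P (sym eq) Pp
    ... | inj₂ eq = subst P (sym eq) Pq

    shift : ∀ t {p p′ q q′} → p ℚ.+ t ≡ p′ → q ℚ.+ t ≡ q′ → p ℚ.≤ q → p′ ℚ.≤ q′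
    shift t refl refl p≤q = ℚ.+-monoˡ-≤ t p≤q

    a+b≤q⇒a≤q-b : ∀ a b q → a ℚ.+ b ℚ.≤ q → a ℚ.≤ q ℚ.- b
    a+b≤q⇒a≤q-b a b q = shift (ℚ.- b)
      (solve 2 (λ a b → a :+ b :- b := a) refl a b) refl

    -q≤a+b⇒-b≤q+a : ∀ a b q → ℚ.- q ℚ.≤ a ℚ.+ b → ℚ.- b ℚ.≤ q ℚ.+ a
    -q≤a+b⇒-b≤q+a a b q = shift (q ℚ.- b)
      (solve 2 (λ b q → :- q :+ (q :- b) := :- b) refl b q)
      (solve 3 (λ a b q → a :+ b :+ (q :- b) := q :+ a) refl a b q)

    a≤q+c⇒a-c≤q : ∀ a c q → a ℚ.≤ q ℚ.+ c → a ℚ.- c ℚ.≤ q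
    a≤q+c⇒a-c≤q a c q = shift (ℚ.- c) refl
      (solve 2 (λ c q → q :+ c :- c := q) refl c q)

    c≤q+a⇒-q≤a-c : ∀ a c q → c ℚ.≤ q ℚ.+ a → ℚ.- q ℚ.≤ a ℚ.- c
    c≤q+a⇒-q≤a-c a c q = shift (ℚ.- q ℚ.- c)
      (solve 2 (λ c q → c :+ (:- q :- c) := :- q) refl c q)
      (solve 3 (λ a c q → q :+ a :+ (:- q :- c) := a :- c) refl a c q)

    a≤q+c⇒-c≤q-a : ∀ a c q → a ℚ.≤ q ℚ.+ c → ℚ.- c ℚ.≤ q ℚ.- a
    a≤q+c⇒-c≤q-a a c q = shift (ℚ.- a ℚ.- c)
      (solve 2 (λ a c → a :+ (:- a :- c) := :- c) refl a c)
      (solve 3 (λ a c q → q :+ c :+ (:- a :- c) := q :- a) refl a c q)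

    interchange : ∀ p q r s → (p ℚ.+ q) ℚ.+ (r ℚ.+ s) ≡ (p ℚ.+ r) ℚ.+ (q ℚ.+ s)
    interchange = solve 4 (λ p q r s → (p :+ q) :+ (r :+ s) := (p :+ r) :+ (q :+ s)) refl

open Rat

abstract
  -- Each cut is approximated to any positive rational precision: walk upwards from a lower
  -- bound p in steps of δ; n bounds the number of steps left.
  walk : (x : ℝ) → ∀ {δ} → 0ℚ ℚ.< δ → ∀ n {p b} → lower x p → upper x b →
         b ℚ.< p ℚ.+ fromℕ n ℚ.* δ →
         ∃₂ λ c d → lower x c × upper x d × d ℚ.≤ c ℚ.+ (δ ℚ.+ δ)
  walk x {δ} 0<δ zero {p} {b} p∈L b∈U b<p = ⊥-elim (ℚ.<-asym (lower<upper x p∈L b∈U)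
    (ℚ.<-respʳ-≡ (trans (cong (p ℚ.+_) (ℚ.*-zeroˡ δ)) (ℚ.+-identityʳ p)) b<p))
  walk x {δ} 0<δ (suc n) {p} {b} p∈L b∈U b<p with located x (ℚ.+-monoʳ-< p (p<p+ε δ 0<δ))
  ... | inj₂ u = p , _ , p∈L , u , ℚ.≤-refl
  ... | inj₁ l = walk x 0<δ n l b∈U (ℚ.<-respʳ-≡ eq b<p)
    where
    open +-*-Solver
    eq : p ℚ.+ fromℕ (suc n) ℚ.* δ ≡ p ℚ.+ δ ℚ.+ fromℕ n ℚ.* δ
    eq = trans (cong (λ t → p ℚ.+ t ℚ.* δ) (fromℕ-suc n))
      (solve 3 (λ p t δ → p :+ (con 1ℚ :+ t) :* δ := p :+ δ :+ t :* δ) refl p (fromℕ n) δ)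

  approximate : (x : ℝ) → ∀ {ε} → 0ℚ ℚ.< ε →
                ∃₂ λ c d → lower x c × upper x d × d ℚ.≤ c ℚ.+ ε
  approximate x {ε} 0<ε =
    let p , p∈L = lower-inhabited x
        b , b∈U = upper-inhabited x
        n , lt  = archimedean (b ℚ.- p) (0<half 0<ε)
        c , d , c∈L , d∈U , d≤ = walk x (0<half 0<ε) n p∈L b∈U
          (ℚ.<-respˡ-≡ (p+[q-p] p b) (ℚ.+-monoʳ-< p lt))
    in  c , d , c∈L , d∈U , subst (λ t → d ℚ.≤ c ℚ.+ t) (half+half ε) d≤

fromℚ : ℚ → ℝ
fromℚ p = record
  { lower = ℚ._< p
  ; upper = p ℚ.<_
  ; lower-inhabited = p ℚ.- 1ℚ , p-1<p p
  ; upper-inhabited = p ℚ.+ 1ℚ , p<p+1 p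
  ; lower-closed = ℚ.≤-<-trans
  ; upper-closed = λ q≤r p<q → ℚ.<-≤-trans p<q q≤r
  ; lower-rounded = λ q<p → let r , q<r , r<p = ℚ.<-dense q<p in r , q<r , r<p
  ; upper-rounded = λ p<r → let q , p<q , q<r = ℚ.<-dense p<r in q , q<r , p<q
  ; lower<upper = ℚ.<-trans
  ; located = λ {q} q<r → case-< q q<r
  }
  where
  case-< : ∀ q {r} → q ℚ.< r → q ℚ.< p ⊎ p ℚ.< r
  case-< q q<r with q ℚ.<? p
  ... | yes q<p = inj₁ q<p
  ... | no  q≮p = inj₂ (ℚ.≤-<-trans (ℚ.≮⇒≥ q≮p) q<r)

0ℝ : ℝ
0ℝ = fromℚ 0ℚ

infixl 6 _+_ _-_
infix  8 -_
infixr 7 _⊓_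
infixr 6 _⊔_

_+_ : ℝ → ℝ → ℝ
x + y = record
  { lower = λ q → ∃₂ λ c d → lower x c × lower y d × q ℚ.≤ c ℚ.+ d
  ; upper = λ q → ∃₂ λ c d → upper x c × upper y d × c ℚ.+ d ℚ.≤ q
  ; lower-inhabited =
      let c , c∈ = lower-inhabited x; d , d∈ = lower-inhabited y
      in  c ℚ.+ d , c , d , c∈ , d∈ , ℚ.≤-refl
  ; upper-inhabited =
      let c , c∈ = upper-inhabited x; d , d∈ = upper-inhabited y
      in  c ℚ.+ d , c , d , c∈ , d∈ , ℚ.≤-refl
  ; lower-closed = λ q≤r (c , d , c∈ , d∈ , r≤) → c , d , c∈ , d∈ , ℚ.≤-trans q≤r r≤
  ; upper-closed = λ q≤r (c , d , c∈ , d∈ , ≤q) → c , d , c∈ , d∈ , ℚ.≤-trans ≤q q≤r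
  ; lower-rounded = λ (c , d , c∈ , d∈ , q≤) →
      let c′ , c<c′ , c′∈ = lower-rounded x c∈
      in  c′ ℚ.+ d , ℚ.≤-<-trans q≤ (ℚ.+-monoˡ-< d c<c′) , c′ , d , c′∈ , d∈ , ℚ.≤-refl
  ; upper-rounded = λ (c , d , c∈ , d∈ , ≤r) →
      let c′ , c′<c , c′∈ = upper-rounded x c∈
      in  c′ ℚ.+ d , ℚ.<-≤-trans (ℚ.+-monoˡ-< d c′<c) ≤r , c′ , d , c′∈ , d∈ , ℚ.≤-refl
  ; lower<upper = λ (c , d , c∈ , d∈ , q≤) (c′ , d′ , c′∈ , d′∈ , ≤r) →
      ℚ.≤-<-trans q≤ (ℚ.<-≤-trans
        (ℚ.+-mono-< (lower<upper x c∈ c′∈) (lower<upper y d∈ d′∈)) ≤r)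
  ; located = +-located
  }
  where
  choose : ∀ {q r c d} → lower x c → upper x d → lower y (q ℚ.- c) ⊎ upper y (r ℚ.- d) →
    (∃₂ λ c d → lower x c × lower y d × q ℚ.≤ c ℚ.+ d) ⊎
    (∃₂ λ c d → upper x c × upper y d × c ℚ.+ d ℚ.≤ r)
  choose {q} {r} {c} {d} c∈ d∈ (inj₁ l) =
    inj₁ (c , q ℚ.- c , c∈ , l , ℚ.≤-reflexive (sym (p+[q-p] c q)))
  choose {q} {r} {c} {d} c∈ d∈ (inj₂ u) =
    inj₂ (d , r ℚ.- d , d∈ , u , ℚ.≤-reflexive (p+[q-p] d r))

  +-located : ∀ {q r} → q ℚ.< r →
    (∃₂ λ c d → lower x c × lower y d × q ℚ.≤ c ℚ.+ d) ⊎
    (∃₂ λ c d → upper x c × upper y d × c ℚ.+ d ℚ.≤ r)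
  +-located {q} {r} q<r =
    let c , d , c∈ , d∈ , d≤ = approximate x (0<half (<⇒0<- q<r))
    in  choose {q} {r} {c} {d} c∈ d∈
          (located y {q ℚ.- c} {r ℚ.- d} (gap {q} {r} {c} {d} q<r d≤))

-_ : ℝ → ℝ
- x = record
  { lower = λ q → upper x (ℚ.- q)
  ; upper = λ q → lower x (ℚ.- q)
  ; lower-inhabited = let q , q∈ = upper-inhabited x in ℚ.- q , subst (upper x) (sym (neg-neg q)) q∈
  ; upper-inhabited = let q , q∈ = lower-inhabited x in ℚ.- q , subst (lower x) (sym (neg-neg q)) q∈
  ; lower-closed = λ q≤r → upper-closed x (ℚ.neg-antimono-≤ q≤r)
  ; upper-closed = λ q≤r → lower-closed x (ℚ.neg-antimono-≤ q≤r)
  ; lower-rounded = λ {q} q∈ →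
      let r , r<-q , r∈ = upper-rounded x q∈
      in  ℚ.- r , ℚ.<-respˡ-≡ (neg-neg q) (ℚ.neg-antimono-< r<-q)
                , subst (upper x) (sym (neg-neg r)) r∈
  ; upper-rounded = λ {q} q∈ →
      let r , -q<r , r∈ = lower-rounded x q∈
      in  ℚ.- r , ℚ.<-respʳ-≡ (neg-neg q) (ℚ.neg-antimono-< -q<r)
                , subst (lower x) (sym (neg-neg r)) r∈
  ; lower<upper = λ {q} {r} q∈ r∈ →
      subst₂ ℚ._<_ (neg-neg q) (neg-neg r) (ℚ.neg-antimono-< (lower<upper x r∈ q∈))
  ; located = λ q<r → [ inj₂ , inj₁ ]′ (located x (ℚ.neg-antimono-< q<r))
  }

_-_ : ℝ → ℝ → ℝ
x - y = x + (- y)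

_⊔_ : ℝ → ℝ → ℝ
x ⊔ y = record
  { lower = λ q → lower x q ⊎ lower y q
  ; upper = λ q → upper x q × upper y q
  ; lower-inhabited = let q , q∈ = lower-inhabited x in q , inj₁ q∈
  ; upper-inhabited =
      let q , q∈ = upper-inhabited x; r , r∈ = upper-inhabited y
      in  q ℚ.⊔ r , upper-closed x (ℚ.p≤p⊔q q r) q∈ , upper-closed y (ℚ.p≤q⊔p q r) r∈
  ; lower-closed = λ q≤r → [ inj₁ ∘ lower-closed x q≤r , inj₂ ∘ lower-closed y q≤r ]′
  ; upper-closed = λ q≤r (q∈x , q∈y) → upper-closed x q≤r q∈x , upper-closed y q≤r q∈y
  ; lower-rounded = λ where
      (inj₁ q∈) → let r , q<r , r∈ = lower-rounded x q∈ in r , q<r , inj₁ r∈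
      (inj₂ q∈) → let r , q<r , r∈ = lower-rounded y q∈ in r , q<r , inj₂ r∈
  ; upper-rounded = λ (r∈x , r∈y) →
      let p , p<r , p∈ = upper-rounded x r∈x; q , q<r , q∈ = upper-rounded y r∈y
      in  p ℚ.⊔ q , ⊔-< p<r q<r
        , upper-closed x (ℚ.p≤p⊔q p q) p∈ , upper-closed y (ℚ.p≤q⊔p p q) q∈
  ; lower<upper = λ where
      (inj₁ q∈) (r∈ , _) → lower<upper x q∈ r∈
      (inj₂ q∈) (_ , r∈) → lower<upper y q∈ r∈
  ; located = ⊔-located
  }
  where
  ⊔-< : ∀ {p q r} → p ℚ.< r → q ℚ.< r → p ℚ.⊔ q ℚ.< r
  ⊔-< {p} {q} {r} p<r q<r = ⊔-elim (ℚ._< r) p q p<r q<r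

  ⊔-located : ∀ {q r} → q ℚ.< r → (lower x q ⊎ lower y q) ⊎ (upper x r × upper y r)
  ⊔-located q<r with located x q<r | located y q<r
  ... | inj₁ l | _      = inj₁ (inj₁ l)
  ... | inj₂ _ | inj₁ l = inj₁ (inj₂ l)
  ... | inj₂ u | inj₂ v = inj₂ (u , v)

_⊓_ : ℝ → ℝ → ℝ
x ⊓ y = - ((- x) ⊔ (- y))

∣_∣ : ℝ → ℝ
∣ x ∣ = x ⊔ (- x)

------------------------------------------------------------------------
-- Connectives

Continuous : ∀ {k} → (Vector ℝ k → ℝ) → Set₁
Continuous f = ∀ u {ε} → 0ℝ < ε →
  ∃ λ δ → 0ℝ < δ × (∀ v → (∀ i → ∣ u i - v i ∣ < δ) → ∣ f u - f v ∣ < ε)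

module Estimates where
  -- Rational bounds witnessing x < y + q.
  Near : ℝ → ℝ → ℚ → Set
  Near x y q = ∃₂ λ p r → upper x p × lower y r × p ℚ.≤ q ℚ.+ r

  abstract
    <⇒Near : ∀ x y ε → ∣ x - y ∣ < ε → ∃ λ q → lower ε q × Near x y q × Near y x q
    <⇒Near x y ε (q , ((p , r , p∈ , r∈ , ≤q) , (p′ , r′ , p′∈ , r′∈ , -q≤)) , q∈) =
      q , q∈ , (p , ℚ.- r , p∈ , r∈ , a+b≤q⇒a≤q-b p r q ≤q)
             , (ℚ.- r′ , p′ , r′∈ , p′∈ , -q≤a+b⇒-b≤q+a p′ r′ q -q≤)

    Near⇒< : ∀ x y ε q → lower ε q → Near x y q → Near y x q → ∣ x - y ∣ < ε
    Near⇒< x y ε q q∈ (p , r , p∈ , r∈ , p≤) (r′ , p′ , r′∈ , p′∈ , r′≤) =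
      q , ( (p , ℚ.- r , p∈ , subst (lower y) (sym (neg-neg r)) r∈ , a≤q+c⇒a-c≤q p r q p≤)
          , (p′ , ℚ.- r′ , p′∈ , subst (upper y) (sym (neg-neg r′)) r′∈
                , c≤q+a⇒-q≤a-c p′ r′ q r′≤))
        , q∈

    near-refl : ∀ x {q} → 0ℚ ℚ.< q → Near x x q
    near-refl x {q} 0<q =
      let c , d , c∈ , d∈ , d≤ = approximate x 0<q
      in  d , c , d∈ , c∈ , ℚ.≤-trans d≤ (ℚ.≤-reflexive (ℚ.+-comm c q))

    near-neg : ∀ x y q → Near x y q → Near (- y) (- x) q
    near-neg x y q (p , r , p∈ , r∈ , p≤) =
      ℚ.- r , ℚ.- p , subst (lower y) (sym (neg-neg r)) r∈
            , subst (upper x) (sym (neg-neg p)) p∈ , a≤q+c⇒-c≤q-a p r q p≤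

    near-+ : ∀ x y q x′ y′ q′ → Near x y q → Near x′ y′ q′ → Near (x + x′) (y + y′) (q ℚ.+ q′)
    near-+ x y q x′ y′ q′ (p , r , p∈ , r∈ , p≤) (p′ , r′ , p′∈ , r′∈ , p′≤) =
      p ℚ.+ p′ , r ℚ.+ r′ , (p , p′ , p∈ , p′∈ , ℚ.≤-refl) , (r , r′ , r∈ , r′∈ , ℚ.≤-refl)
               , ℚ.≤-trans (ℚ.+-mono-≤ p≤ p′≤) (ℚ.≤-reflexive (interchange q r q′ r′))

    near-⊔ : ∀ x y q x′ y′ q′ → Near x y q → Near x′ y′ q′ → Near (x ⊔ x′) (y ⊔ y′) (q ℚ.⊔ q′)
    near-⊔ x y q x′ y′ q′ (p , r , p∈ , r∈ , p≤) (p′ , r′ , p′∈ , r′∈ , p′≤) =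
      p ℚ.⊔ p′ , r ℚ.⊔ r′
      , (upper-closed x (ℚ.p≤p⊔q p p′) p∈ , upper-closed x′ (ℚ.p≤q⊔p p p′) p′∈)
      , r⊔r′∈
      , ⊔-elim (ℚ._≤ (q ℚ.⊔ q′) ℚ.+ (r ℚ.⊔ r′)) p p′
          (ℚ.≤-trans p≤ (ℚ.+-mono-≤ (ℚ.p≤p⊔q q q′) (ℚ.p≤p⊔q r r′)))
          (ℚ.≤-trans p′≤ (ℚ.+-mono-≤ (ℚ.p≤q⊔p q q′) (ℚ.p≤q⊔p r r′)))
      where
      r⊔r′∈ : lower y (r ℚ.⊔ r′) ⊎ lower y′ (r ℚ.⊔ r′)
      r⊔r′∈ with ℚ.⊔-sel r r′
      ... | inj₁ eq = inj₁ (subst (lower y) (sym eq) r∈)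
      ... | inj₂ eq = inj₂ (subst (lower y′) (sym eq) r′∈)

    near-⊓ : ∀ x y q x′ y′ q′ → Near x y q → Near x′ y′ q′ → Near (x ⊓ x′) (y ⊓ y′) (q ℚ.⊔ q′)
    near-⊓ x y q x′ y′ q′ n n′ = near-neg ((- y) ⊔ (- y′)) ((- x) ⊔ (- x′)) (q ℚ.⊔ q′)
      (near-⊔ (- y) (- x) q (- y′) (- x′) q′ (near-neg x y q n) (near-neg x′ y′ q′ n′))

    fromℚ-pos : ∀ {q} → 0ℚ ℚ.< q → 0ℝ < fromℚ q
    fromℚ-pos 0<q = let r , 0<r , r<q = ℚ.<-dense 0<q in r , 0<r , r<q

    ⊔-continuous : Continuous {2} (λ u → u zero ⊔ u (suc zero))
    ⊔-continuous u {ε} 0<ε = ε , 0<ε , λ v close →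
      let x = u zero; y = v zero; x′ = u (suc zero); y′ = v (suc zero)
          q  , q∈  , n  , m  = <⇒Near x  y  ε (close zero)
          q′ , q′∈ , n′ , m′ = <⇒Near x′ y′ ε (close (suc zero))
      in  Near⇒< (x ⊔ x′) (y ⊔ y′) ε (q ℚ.⊔ q′) (⊔-elim (lower ε) q q′ q∈ q′∈)
            (near-⊔ x y q x′ y′ q′ n n′) (near-⊔ y x q y′ x′ q′ m m′)

    ⊓-continuous : Continuous {2} (λ u → u zero ⊓ u (suc zero))
    ⊓-continuous u {ε} 0<ε = ε , 0<ε , λ v close →
      let x = u zero; y = v zero; x′ = u (suc zero); y′ = v (suc zero)
          q  , q∈  , n  , m  = <⇒Near x  y  ε (close zero)
          q′ , q′∈ , n′ , m′ = <⇒Near x′ y′ ε (close (suc zero))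
      in  Near⇒< (x ⊓ x′) (y ⊓ y′) ε (q ℚ.⊔ q′) (⊔-elim (lower ε) q q′ q∈ q′∈)
            (near-⊓ x y q x′ y′ q′ n n′) (near-⊓ y x q y′ x′ q′ m m′)

    sub-continuous : Continuous {2} (λ u → u zero - u (suc zero))
    sub-continuous u {ε} (e , 0<e , e∈) = fromℚ (half e) , fromℚ-pos (0<half 0<e) , λ v close →
      let x = u zero; y = v zero; x′ = u (suc zero); y′ = v (suc zero)
          q  , q<  , n  , m  = <⇒Near x  y  (fromℚ (half e)) (close zero)
          q′ , q′< , n′ , m′ = <⇒Near x′ y′ (fromℚ (half e)) (close (suc zero))
      in  Near⇒< (x - x′) (y - y′) ε (q ℚ.+ q′)
            (lower-closed ε (ℚ.<⇒≤ (ℚ.<-respʳ-≡ (half+half e) (ℚ.+-mono-< q< q′<))) e∈)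
            (near-+ x y q (- x′) (- y′) q′ n (near-neg y′ x′ q′ m′))
            (near-+ y x q (- y′) (- x′) q′ m (near-neg x′ y′ q′ n′))

    const-continuous : ∀ r → Continuous {0} (λ _ → r)
    const-continuous r u {ε} 0<ε@(q , 0<q , q∈) = ε , 0<ε , λ _ _ →
      Near⇒< r r ε q q∈ (near-refl r 0<q) (near-refl r 0<q)

open Estimates

record Connective (k : ℕ) : Set₁ where
  field
    apply : Vector ℝ k → ℝ
    continuous : Continuous apply

open Connective

Unary : Set₁
Unary = Connective 1

infix 10 _⟨_⟩

_⟨_⟩ : Unary → ℝ → ℝ
C ⟨ x ⟩ = apply C (λ _ → x)

Nondecreasing Nonincreasing : Unary → Set₁
Nondecreasing C = ∀ {x y} → x ≤ y → C ⟨ x ⟩ ≤ C ⟨ y ⟩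
Nonincreasing D = ∀ {x y} → x ≤ y → D ⟨ y ⟩ ≤ D ⟨ x ⟩

maxᶜ minᶜ subᶜ : Connective 2
maxᶜ = record { apply = λ u → u zero ⊔ u (suc zero) ; continuous = ⊔-continuous }
minᶜ = record { apply = λ u → u zero ⊓ u (suc zero) ; continuous = ⊓-continuous }
subᶜ = record { apply = λ u → u zero - u (suc zero) ; continuous = sub-continuous }

constᶜ : ℝ → Connective 0
constᶜ r = record { apply = λ _ → r ; continuous = const-continuous r }

------------------------------------------------------------------------
-- Metric signatures and structures

ℝ⁺ : Set₁
ℝ⁺ = Σ ℝ (0ℝ <_)

Modulus : Set₁
Modulus = ℝ⁺ → ℝ⁺

-- Constants are function symbols of arity 0.
record Signature s : Set (lsuc 0ℓ ⊔ˡ lsuc s) where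
  field
    Fun Rel : Set s
    arityᶠ : Fun → ℕ
    arityᴿ : Rel → ℕ
    diameter : ℝ
    lowerBound upperBound : Rel → ℝ
    modulusᶠ : Fun → Modulus
    modulusᴿ : Rel → Modulus

-- The interpretation of the symbols alone.  Two points at distance 0 are equal: the metric
-- space meant is the quotient of Carrier by d x y ≈ 0ℝ.
record RawStructure (L : Signature s) ℓ : Set (lsuc 0ℓ ⊔ˡ s ⊔ˡ lsuc ℓ) where
  open Signature L
  field
    Carrier : Set ℓ
    d : Carrier → Carrier → ℝ
    fun : (g : Fun) → Vector Carrier (arityᶠ g) → Carrier
    rel : (p : Rel) → Vector Carrier (arityᴿ p) → ℝ

record IsStructure {L : Signature s} (M : RawStructure L ℓ) : Set (lsuc 0ℓ ⊔ˡ s ⊔ˡ ℓ) where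
  open Signature L
  open RawStructure M

  Cauchy : (ℕ → Carrier) → Set₁
  Cauchy x = ∀ {ε} → 0ℝ < ε →
    ∃ λ N → ∀ {m n} → N ℕ.≤ m → N ℕ.≤ n → d (x m) (x n) < ε

  _⟶_ : (ℕ → Carrier) → Carrier → Set₁
  x ⟶ z = ∀ {ε} → 0ℝ < ε → ∃ λ N → ∀ {n} → N ℕ.≤ n → d (x n) z < ε

  field
    nonempty : Carrier
    d-nonneg : ∀ x y → 0ℝ ≤ d x y
    d-refl : ∀ x → d x x ≈ 0ℝ
    d-sym : ∀ x y → d x y ≈ d y x
    d-triangle : ∀ x y z → d x z ≤ d x y + d y z
    d-bounded : ∀ x y → d x y ≤ diameter
    complete : ∀ x → Cauchy x → ∃ λ z → x ⟶ z
    fun-uniform : ∀ g (ε : ℝ⁺) u v →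
      (∀ i → d (u i) (v i) < proj₁ (modulusᶠ g ε)) → d (fun g u) (fun g v) ≤ proj₁ ε
    rel-uniform : ∀ p (ε : ℝ⁺) u v →
      (∀ i → d (u i) (v i) < proj₁ (modulusᴿ p ε)) → ∣ rel p u - rel p v ∣ ≤ proj₁ ε
    rel-bounded : ∀ p u → lowerBound p ≤ rel p u × rel p u ≤ upperBound p

record Structure (L : Signature s) ℓ : Set (lsuc 0ℓ ⊔ˡ s ⊔ˡ lsuc ℓ) where
  field
    raw : RawStructure L ℓ
    isStructure : IsStructure raw

  open RawStructure raw public
  open IsStructure isStructure public

------------------------------------------------------------------------
-- Formulas

-- Terms and formulas in n free variables (de Bruijn indices): quantifiers bind index 0.
data Term (L : Signature s) (n : ℕ) : Set s where
  var : Fin n → Term L n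
  fun : (g : Signature.Fun L) → Vector (Term L n) (Signature.arityᶠ L g) → Term L n

data Formula (L : Signature s) : ℕ → Set (lsuc 0ℓ ⊔ˡ s) where
  rel : ∀ {n} (p : Signature.Rel L) → Vector (Term L n) (Signature.arityᴿ L p) → Formula L n
  dist : ∀ {n} → Term L n → Term L n → Formula L n
  conn : ∀ {n k} → Connective k → Vector (Formula L n) k → Formula L n
  inf sup : ∀ {n} → Formula L (suc n) → Formula L n

Sentence : Signature s → Set (lsuc 0ℓ ⊔ˡ s)
Sentence L = Formula L 0

module _ {L : Signature s} {n : ℕ} where

  infixl 6 _⊖_
  infix  10 _·_

  maxᶠ minᶠ _⊖_ : Formula L n → Formula L n → Formula L n
  maxᶠ φ ψ = conn maxᶜ (φ ∷ᵛ ψ ∷ᵛ []ᵛ)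
  minᶠ φ ψ = conn minᶜ (φ ∷ᵛ ψ ∷ᵛ []ᵛ)
  φ ⊖ ψ = conn subᶜ (φ ∷ᵛ ψ ∷ᵛ []ᵛ)

  constᶠ : ℝ → Formula L n
  constᶠ r = conn (constᶜ r) []ᵛ

  _·_ : Unary → Formula L n → Formula L n
  C · φ = conn C (λ _ → φ)

  Maxᶠ : ∀ {k} → Vector (Formula L n) (suc k) → Formula L n
  Maxᶠ {zero}  φ = φ zero
  Maxᶠ {suc k} φ = maxᶠ (φ zero) (Maxᶠ (φ ∘ suc))

module _ {L : Signature s} where

  -- Quantification over the tuple of the first k variables.
  inf⋆ : ∀ k {m} → Formula L (k ℕ.+ m) → Formula L m
  inf⋆ zero    φ = φ
  inf⋆ (suc k) φ = inf⋆ k (inf φ)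

  sup⋆ : ∀ m → Formula L m → Sentence L
  sup⋆ zero    φ = φ
  sup⋆ (suc m) φ = sup⋆ m (sup φ)

data Palyutin {L : Signature s} : ∀ {n} → Formula L n → Set (lsuc 0ℓ ⊔ˡ s) where
  rel : ∀ {n} p (t : Vector (Term L n) _) → Palyutin (rel p t)
  dist : ∀ {n} (t u : Term L n) → Palyutin (dist t u)
  mono : ∀ {n} {φ : Formula L n} C → Nondecreasing C → Palyutin φ → Palyutin (C · φ)
  max : ∀ {n} {φ ψ : Formula L n} → Palyutin φ → Palyutin ψ → Palyutin (maxᶠ φ ψ)
  inf : ∀ {n} {φ : Formula L (suc n)} → Palyutin φ → Palyutin (inf φ)
  sup : ∀ {n} {φ : Formula L (suc n)} → Palyutin φ → Palyutin (sup φ)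
  fixed : ∀ {n} {φ ψ : Formula L (suc n)} D Δ → Nonincreasing D → D ⟨ Δ ⟩ ≈ Δ →
    Palyutin φ → Palyutin ψ →
    Palyutin (maxᶠ (inf φ) (sup (minᶠ (D · φ) (minᶠ (constᶠ Δ) ψ))))

-- The condition  sentence ≤ bound.
infix 5 _≤ᶜ_

record Condition (L : Signature s) : Set (lsuc 0ℓ ⊔ˡ s) where
  constructor _≤ᶜ_
  field
    sentence : Sentence L
    bound : ℝ

Theory : Signature s → Set (lsuc (lsuc 0ℓ ⊔ˡ s))
Theory {s} L = Pred (Condition L) (lsuc 0ℓ ⊔ˡ s)

-- The first k of the k + m variables are the tuple x, the remaining m are the tuple y.
data SCP (L : Signature s) : Theory L where
  scp : ∀ n k m (φ : Formula L (k ℕ.+ m)) (ψ : Vector (Formula L (k ℕ.+ m)) (2+ n))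
    (D : Vector Unary (2+ n)) →
    Palyutin φ → (∀ j → Palyutin (ψ j)) → (∀ j → Nonincreasing (D j)) →
    SCP L (sup⋆ m (inf⋆ k (maxᶠ φ (Maxᶠ λ j → D j · ψ j))
                   ⊖ Maxᶠ (λ j → inf⋆ k (maxᶠ φ (D j · ψ j))))
           ≤ᶜ 0ℝ)

------------------------------------------------------------------------
-- Filters

-- Proper filters; properness forces I to be nonempty.  Classically Pred I 0ℓ contains, up to
-- extensional equality, every subset of I.
record Filter (I : Set ι) f : Set (lsuc 0ℓ ⊔ˡ ι ⊔ˡ lsuc f) where
  field
    sets : Pred (Pred I 0ℓ) f
    univ : U ∈ᴾ sets
    inter : ∀ {X Y} → X ∈ᴾ sets → Y ∈ᴾ sets → X ∩ Y ∈ᴾ sets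
    upward : ∀ {X Y} → X ⊆ Y → X ∈ᴾ sets → Y ∈ᴾ sets
    proper : ∅ ∉ᴾ sets

Cofinite : Pred (Pred ℕ 0ℓ) 0ℓ
Cofinite X = ∃ λ (ns : List ℕ) → ∀ n → n ∉ᴾ X → n ∈ ns

Fréchet : Filter ℕ 0ℓ
Fréchet = record
  { sets = Cofinite
  ; univ = [] , λ n n∉U → ⊥-elim (n∉U _)
  ; inter = inter
  ; upward = λ X⊆Y (ns , p) → ns , λ n n∉Y → p n (n∉Y ∘ X⊆Y)
  ; proper = λ (ns , p) → ℕ.<-irrefl refl (≤sum (p (suc (sum ns)) λ ()))
  }
  where
  open DecMembership ℕ._≟_ using (_∈?_)

  inter : ∀ {X Y} → X ∈ᴾ Cofinite → Y ∈ᴾ Cofinite → X ∩ Y ∈ᴾ Cofinite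
  inter {X} {Y} (ms , p) (ns , q) = ms ++ ns , covers
    where
    covers : ∀ n → n ∉ᴾ X ∩ Y → n ∈ ms ++ ns
    covers n n∉ with n ∈? ms | n ∈? ns
    ... | yes n∈ms | _        = ∈-++⁺ˡ n∈ms
    ... | no _     | yes n∈ns = ∈-++⁺ʳ ms n∈ns
    ... | no n∉ms  | no n∉ns  =
      ⊥-elim (n∉ms (p n λ n∈X → n∉ns (q n λ n∈Y → n∉ (n∈X , n∈Y))))

  ≤sum : ∀ {n ns} → n ∈ ns → n ℕ.≤ sum ns
  ≤sum {ns = m ∷ ns} (here refl) = ℕ.m≤m+n m (sum ns)
  ≤sum {ns = m ∷ ns} (there n∈)  = ℕ.≤-trans (≤sum n∈) (ℕ.m≤n+m (sum ns) m)

-- The reduced power by F of the two-element Boolean algebra.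
𝟚^_ : {I : Set ι} → Filter I f → BooleanAlgebra ι f
𝟚^_ {I = I} F = record
  { Carrier = I → Bool
  ; _≈_ = λ u v → (λ i → u i ≡ v i) ∈ᴾ sets
  ; _∨_ = λ u v i → u i Bool.∨ v i
  ; _∧_ = λ u v i → u i Bool.∧ v i
  ; ¬_ = λ u i → Bool.not (u i)
  ; ⊤ = λ _ → true
  ; ⊥ = λ _ → false
  ; isBooleanAlgebra = isBooleanAlgebraʳ record
    { isDistributiveLattice = isDistributiveLatticeʳʲᵐ record
      { isLattice = record
        { isEquivalence = record
          { refl = everywhere λ _ → refl
          ; sym = upward sym
          ; trans = λ p q → upward (λ (e , e′) → trans e e′) (inter p q)
          }
        ; ∨-comm = λ u v → everywhere λ i → Bool.∨-comm (u i) (v i)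
        ; ∨-assoc = λ u v w → everywhere λ i → Bool.∨-assoc (u i) (v i) (w i)
        ; ∨-cong = λ p q → upward (λ (e , e′) → cong₂ Bool._∨_ e e′) (inter p q)
        ; ∧-comm = λ u v → everywhere λ i → Bool.∧-comm (u i) (v i)
        ; ∧-assoc = λ u v w → everywhere λ i → Bool.∧-assoc (u i) (v i) (w i)
        ; ∧-cong = λ p q → upward (λ (e , e′) → cong₂ Bool._∧_ e e′) (inter p q)
        ; absorptive = (λ u v → everywhere λ i → Bool.∨-abs-∧ (u i) (v i))
                     , (λ u v → everywhere λ i → Bool.∧-abs-∨ (u i) (v i))
        }
      ; ∨-distribʳ-∧ = λ u v w → everywhere λ i → Bool.∨-distribʳ-∧ (u i) (v i) (w i)
      }
    ; ∨-complementʳ = λ u → everywhere λ i → Bool.∨-inverseʳ (u i)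
    ; ∧-complementʳ = λ u → everywhere λ i → Bool.∧-inverseʳ (u i)
    ; ¬-cong = upward (cong Bool.not)
    }
  }
  where
  open Filter F
  everywhere : {X : Pred I 0ℓ} → (∀ i → X i) → X ∈ᴾ sets
  everywhere p = upward (λ {i} _ → p i) univ

module _ (B : BooleanAlgebra a b) where
  open BooleanAlgebra B using (Carrier; lattice; ⊥) renaming (_≈_ to _≈ᴮ_)
  open Poset (LatticeProperties.poset lattice) using () renaming (_≤_ to _≤ᴮ_)

  IsAtom : Carrier → Set (a ⊔ˡ b)
  IsAtom x = ¬ (x ≈ᴮ ⊥) × (∀ y → y ≤ᴮ x → y ≈ᴮ ⊥ ⊎ y ≈ᴮ x)

  Atomless : Set (a ⊔ˡ b)
  Atomless = ∀ x → ¬ IsAtom x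

------------------------------------------------------------------------
-- Semantics

-- The classical metatheory, taken as a hypothesis.  As it decides every type, with a witness in
-- the positive case, it also provides the axiom of choice.
EM : Setω
EM = ∀ {ℓ} → ExcludedMiddle ℓ

module Classical (em : EM) where

  module _ {A : Set a} (u : A → ℝ) where

    IsSup IsInf : ℝ → Set (lsuc 0ℓ ⊔ˡ a)
    IsSup z = (∀ i → u i ≤ z) × (∀ w → (∀ i → u i ≤ w) → z ≤ w)
    IsInf z = (∀ i → z ≤ u i) × (∀ w → (∀ i → w ≤ u i) → w ≤ z)

    -- Bounded nonempty families have a supremum and an infimum; 0ℝ is a dummy value for the
    -- other families, which do not occur when formulas are evaluated in structures.
    ⨆ ⨅ : ℝ
    ⨆ with em {P = ∃ IsSup}
    ... | yes (z , _) = z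
    ... | no _        = 0ℝ
    ⨅ with em {P = ∃ IsInf}
    ... | yes (z , _) = z
    ... | no _        = 0ℝ

  limsup : {I : Set ι} → Filter I f → (I → ℝ) → ℝ
  limsup F u = ⨅ {A = ∃ (Filter.sets F)} λ (J , _) → ⨆ {A = ∃ J} λ (i , _) → u i

  module _ {L : Signature s} (M : RawStructure L ℓ) where
    open RawStructure M renaming (fun to funᴹ; rel to relᴹ)

    ⟦_⟧ᵗ : ∀ {n} → Term L n → Vector Carrier n → Carrier
    ⟦ var i ⟧ᵗ v = v i
    ⟦ fun g t ⟧ᵗ v = funᴹ g (λ i → ⟦ t i ⟧ᵗ v)

    ⟦_⟧ : ∀ {n} → Formula L n → Vector Carrier n → ℝ
    ⟦ rel p t ⟧ v = relᴹ p (λ i → ⟦ t i ⟧ᵗ v)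
    ⟦ dist t u ⟧ v = d (⟦ t ⟧ᵗ v) (⟦ u ⟧ᵗ v)
    ⟦ conn C φ ⟧ v = apply C (λ i → ⟦ φ i ⟧ v)
    ⟦ inf φ ⟧ v = ⨅ λ x → ⟦ φ ⟧ (x ∷ᵛ v)
    ⟦ sup φ ⟧ v = ⨆ λ x → ⟦ φ ⟧ (x ∷ᵛ v)

    infix 4 _⊨_

    _⊨_ : Theory L → Set (lsuc 0ℓ ⊔ˡ s)
    _⊨_ T = ∀ {c} → c ∈ᴾ T → ⟦ Condition.sentence c ⟧ []ᵛ ≤ Condition.bound c

  module _ {L : Signature s} {I : Set ι} (M : I → Structure L ℓ) (F : Filter I f) where
    private module M i = Structure (M i)

    -- Only the interpretation of the symbols, which determines the values of all formulas; the
    -- quotient by d_F(a,b) = 0 is built into the convention on RawStructure.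
    reducedProduct : RawStructure L (ι ⊔ˡ ℓ)
    reducedProduct = record
      { Carrier = ∀ i → M.Carrier i
      ; d = λ x y → limsup F λ i → M.d i (x i) (y i)
      ; fun = λ g x i → M.fun i g (λ k → x k i)
      ; rel = λ p x → limsup F λ i → M.rel i p (λ k → x k i)
      }

module Submission where

-- The value of a Palyutin formula in M_F is the limit superior of its values in the factors.  For
-- clause (5), off the set where the inner minimum is large one takes near minimisers of φ, where
-- D φ ≥ Δ, so that the minimum stays large.  Call a set stationary if its complement is not in F:
-- when q < limsup u the set {q < u} is stationary.  Given for each j a witness xʲ of the j-th
-- infimum, the sets where ψⱼ(xʲ) nearly attains its limit superior are stationary, and atomlessness
-- shrinks them to disjoint stationary sets.  The point equal to xʲ on the j-th of these keeps every
-- Dⱼψⱼ small, and φ is small for it as it is small for every xʲ.  The Fréchet filter is atomless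
-- because taking every other element of an infinite set leaves two infinite halves.

open import Defs

open import Level using (Level; 0ℓ) renaming (suc to lsuc; _⊔_ to _⊔ˡ_)
open import Data.Bool.Base as Bool using (Bool; true; false; _∧_; _xor_)
import Data.Bool.Properties as Bool
open import Data.Empty using (⊥-elim)
open import Data.Fin.Base using (Fin; zero; suc)
open import Data.List.Base using ([]; upTo)
open import Data.List.Extrema.Nat using (xs≤max) renaming (max to maxℕ)
open import Data.List.Membership.Propositional.Properties using (∈-upTo⁺)
import Data.List.Relation.Unary.All as All
open import Data.Nat.Base as ℕ using (ℕ; zero; suc)
import Data.Nat.Properties as ℕ
open import Data.Product.Base using (∃; ∃₂; _×_; _,_; proj₁; proj₂)
open import Data.Rational.Base as ℚ using (ℚ; 0ℚ; 1ℚ)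
import Data.Rational.Properties as ℚ
open import Data.Sum.Base using (_⊎_; inj₁; inj₂; [_,_]′)
open import Data.Unit.Base using (tt)
open import Data.Vec.Functional using (Vector) renaming ([] to []ᵛ; _∷_ to _∷ᵛ_)
open import Function.Base using (_∘_; id)
open import Relation.Binary.PropositionalEquality using (_≡_; refl; sym; trans; cong; subst)
open import Relation.Nullary using (¬_; Dec; yes; no)
open import Relation.Nullary.Decidable using (True; isYes; toWitness; fromWitness)
open import Relation.Unary using (Pred; _⊆_; _∩_; _∪_; ∁; U) renaming (_∈_ to _∈ᴾ_)

open ℝ
open Connective
open Rat
open Estimates

private variable
  a ℓ ι s f : Level

-- Real numbers as cuts

-- `_≤_` compares lower cuts only; roundedness and locatedness carry the comparison over to upper
-- cuts.
upper-antitone : ∀ x y {q} → x ≤ y → upper y q → upper x q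
upper-antitone x y x≤y q∈ =
  let p , p<q , p∈ = upper-rounded y q∈
  in  [ (λ l → ⊥-elim (ℚ.<-irrefl refl (lower<upper y (x≤y l) p∈))) , id ]′ (located x p<q)

upper⇒¬lower : ∀ x {q} → upper x q → ¬ lower x q
upper⇒¬lower x u l = ℚ.<-irrefl refl (lower<upper x l u)

-- At `q = x` neither cut contains `q`, whence the gap `q < r`. Below, `¬ lower x q` stands for
-- `x ≤ q`.
¬lower⇒upper : ∀ x {q r} → q ℚ.< r → ¬ lower x q → upper x r
¬lower⇒upper x q<r ¬l = [ ⊥-elim ∘ ¬l , id ]′ (located x q<r)

fromℚ-≤ : ∀ x {q} → lower x q → fromℚ q ≤ x
fromℚ-≤ x l p<q = lower-closed x (ℚ.<⇒≤ p<q) l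

≤-fromℚ : ∀ x {q} → ¬ lower x q → x ≤ fromℚ q
≤-fromℚ x {q} ¬l {p} l with p ℚ.<? q
... | yes p<q = p<q
... | no  p≮q = ⊥-elim (¬l (lower-closed x (ℚ.≮⇒≥ p≮q) l))

lower-⊓⁺ : ∀ x y {q} → lower x q → lower y q → lower (x ⊓ y) q
lower-⊓⁺ x y {q} l l′ = subst (lower x) (sym (neg-neg q)) l , subst (lower y) (sym (neg-neg q)) l′

lower-⊓⁻ : ∀ x y {q} → lower (x ⊓ y) q → lower x q × lower y q
lower-⊓⁻ x y {q} (l , l′) = subst (lower x) (neg-neg q) l , subst (lower y) (neg-neg q) l′

lower-⊓₃⁺ : ∀ x y z {q} → lower x q → lower y q → lower z q → lower (x ⊓ (y ⊓ z)) q
lower-⊓₃⁺ x y z lx ly lz = lower-⊓⁺ x (y ⊓ z) lx (lower-⊓⁺ y z ly lz)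

lower-⊓₃⁻ : ∀ x y z {q} → lower (x ⊓ (y ⊓ z)) q → lower x q × lower y q × lower z q
lower-⊓₃⁻ x y z l = let lx , l′ = lower-⊓⁻ x (y ⊓ z) l in lx , lower-⊓⁻ y z l′

≤⇒-≤0 : ∀ x y → x ≤ y → x - y ≤ 0ℝ
≤⇒-≤0 x y x≤y (c , d , c∈ , d∈ , q≤) = ℚ.≤-<-trans q≤
  (ℚ.<-respʳ-≡ (ℚ.+-inverseˡ d) (ℚ.+-monoˡ-< d (lower<upper y (x≤y c∈) d∈)))

arbitrarilySmall⇒≤0 : ∀ x → (∀ ε → 0ℝ < ε → x ≤ ε) → x ≤ 0ℝ
arbitrarilySmall⇒≤0 x x≤ {q} l with q ℚ.<? 0ℚ
... | yes q<0 = q<0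
... | no  q≮0 =
  let r , q<r , r∈ = lower-rounded x l
  in  ⊥-elim (ℚ.<-irrefl refl (x≤ (fromℚ r) (fromℚ-pos (ℚ.≤-<-trans (ℚ.≮⇒≥ q≮0) q<r)) r∈))

≤0⇒< : ∀ x ε → x ≤ 0ℝ → 0ℝ < ε → x < ε
≤0⇒< x ε x≤0 (q , 0<q , q∈) = q , upper-antitone x 0ℝ x≤0 0<q , q∈

≤0⇒+-≤ : ∀ x y → x ≤ 0ℝ → x + y ≤ y
≤0⇒+-≤ x y x≤0 (c , d , c∈ , d∈ , q≤) = lower-closed y (ℚ.≤-trans q≤
  (ℚ.≤-trans (ℚ.+-monoˡ-≤ d (ℚ.<⇒≤ (x≤0 c∈))) (ℚ.≤-reflexive (ℚ.+-identityˡ d)))) d∈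

≤0⇒+-≤ʳ : ∀ x y → y ≤ 0ℝ → x + y ≤ x
≤0⇒+-≤ʳ x y y≤0 (c , d , c∈ , d∈ , q≤) = lower-closed x (ℚ.≤-trans q≤
  (ℚ.≤-trans (ℚ.+-monoʳ-≤ c (ℚ.<⇒≤ (y≤0 d∈))) (ℚ.≤-reflexive (ℚ.+-identityʳ c)))) c∈

∣-∣-small⇒≤ : ∀ x y → (∀ ε → 0ℝ < ε → ∣ x - y ∣ ≤ ε) → x ≤ y
∣-∣-small⇒≤ x y close {q} l =
  let r , q<r , r∈ = lower-rounded x l
      p , q<p , p<r = ℚ.<-dense q<r
  in  [ id
      , (λ p∈ → ⊥-elim (ℚ.<-irrefl {r ℚ.- p} refl
          (close (fromℚ (r ℚ.- p)) (fromℚ-pos (<⇒0<- {p} {r} p<r)) {r ℚ.- p}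
            (inj₁ (r , ℚ.- p , r∈ , subst (upper y) (sym (neg-neg p)) p∈ , ℚ.≤-refl)))))
      ]′ (located y q<p)

-- Continuous connectives

-- Rational points on both sides of `z` are produced because a cut compares a real directly with
-- rationals; a monotone `C` then transfers the comparison.
neighbours : ∀ (C : Unary) z {e} → 0ℚ ℚ.< e →
  ∃₂ λ p p′ → lower z p × upper z p′ ×
    ∣ C ⟨ z ⟩ - C ⟨ fromℚ p ⟩ ∣ < fromℚ e × ∣ C ⟨ z ⟩ - C ⟨ fromℚ p′ ⟩ ∣ < fromℚ e
neighbours C z {e} 0<e =
  let δ , (d , 0<d , d∈) , close = continuous C (λ _ → z) {fromℚ e} (fromℚ-pos 0<e)
      p , p′ , p∈ , p′∈ , p′≤ = approximate z 0<d
      -- Rounding inwards makes `p` and `p′` strict bounds of `fromℚ r` and `fromℚ r′`, as `near`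
      -- asks.
      r  , p<r   , r∈  = lower-rounded z p∈
      r′ , r′<p′ , r′∈ = upper-rounded z p′∈
      p′≤d+p = ℚ.≤-trans p′≤ (ℚ.≤-reflexive (ℚ.+-comm p d))
      near : ∀ w → lower w p → upper w p′ → ∣ C ⟨ z ⟩ - C ⟨ w ⟩ ∣ < fromℚ e
      near w l u = close (λ _ → w) λ _ →
        Near⇒< z w δ d d∈ (p′ , p , p′∈ , l , p′≤d+p) (p′ , p , u , p∈ , p′≤d+p)
  in  r , r′ , r∈ , r′∈
    , near (fromℚ r) p<r (lower<upper z r∈ p′∈) , near (fromℚ r′) (lower<upper z p∈ r′∈) r′<p′

close-lower : ∀ x y {q r} → q ℚ.< r → lower x r → ∣ x - y ∣ < fromℚ (r ℚ.- q) → lower y q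
close-lower x y {q} {r} q<r r∈ close =
  let e , e< , (c , b , c∈ , b∈ , c≤) , _ = <⇒Near x y (fromℚ (r ℚ.- q)) close
      r<e+b = ℚ.<-≤-trans (lower<upper x r∈ c∈) c≤
      q<b = ℚ.≰⇒> λ b≤q → ℚ.<-irrefl refl (ℚ.<-≤-trans r<e+b
        (ℚ.≤-trans (ℚ.+-mono-≤ (ℚ.<⇒≤ e<) b≤q)
          (ℚ.≤-reflexive (trans (ℚ.+-comm (r ℚ.- q) q) (p+[q-p] q r)))))
  in  lower-closed y (ℚ.<⇒≤ q<b) b∈

close-upper : ∀ x y {q r} → q ℚ.< r → upper x q → ∣ x - y ∣ < fromℚ (r ℚ.- q) → upper y r
close-upper x y {q} {r} q<r q∈ close =
  let e , e< , _ , (c , b , c∈ , b∈ , c≤) = <⇒Near x y (fromℚ (r ℚ.- q)) close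
  in  upper-closed y
        (ℚ.≤-trans c≤ (ℚ.≤-trans (ℚ.+-mono-≤ (ℚ.<⇒≤ e<) (ℚ.<⇒≤ (lower<upper x b∈ q∈)))
          (ℚ.≤-reflexive (trans (ℚ.+-comm (r ℚ.- q) q) (p+[q-p] q r))))) c∈

-- A nondecreasing `C` is tested at the point below `z`, a nonincreasing one at the point above; for
-- `continuous-upper` the roles are exchanged.
continuous-lower : ∀ (C : Unary) z {q} → lower (C ⟨ z ⟩) q →
  ∃₂ λ p p′ → lower z p × upper z p′ ×
    lower (C ⟨ fromℚ p ⟩) q × lower (C ⟨ fromℚ p′ ⟩) q
continuous-lower C z q∈ =
  let r , q<r , r∈ = lower-rounded (C ⟨ z ⟩) q∈
      p , p′ , p∈ , p′∈ , close , close′ = neighbours C z (<⇒0<- q<r)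
  in  p , p′ , p∈ , p′∈ , close-lower (C ⟨ z ⟩) (C ⟨ fromℚ p ⟩) q<r r∈ close
                        , close-lower (C ⟨ z ⟩) (C ⟨ fromℚ p′ ⟩) q<r r∈ close′

continuous-upper : ∀ (C : Unary) z {r} → upper (C ⟨ z ⟩) r →
  ∃₂ λ p p′ → lower z p × upper z p′ ×
    upper (C ⟨ fromℚ p ⟩) r × upper (C ⟨ fromℚ p′ ⟩) r
continuous-upper C z r∈ =
  let q , q<r , q∈ = upper-rounded (C ⟨ z ⟩) r∈
      p , p′ , p∈ , p′∈ , close , close′ = neighbours C z (<⇒0<- q<r)
  in  p , p′ , p∈ , p′∈ , close-upper (C ⟨ z ⟩) (C ⟨ fromℚ p ⟩) q<r q∈ close
                        , close-upper (C ⟨ z ⟩) (C ⟨ fromℚ p′ ⟩) q<r q∈ close′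

-- Bounded families of reals

-- The upper bound is weak, so that suprema satisfy it as well; with strict inequality it could be
-- lost.
record Bounded {A : Set a} (u : A → ℝ) : Set a where
  constructor bounded
  field
    {bottom top} : ℚ
    within : ∀ i → lower (u i) bottom × ¬ lower (u i) top

open Bounded

Bounded-∘ : {A : Set a} {B : Set ℓ} {u : A → ℝ} → Bounded u → (g : B → A) → Bounded (u ∘ g)
Bounded-∘ bu g = bounded (within bu ∘ g)

bounded-cong : {A : Set a} {u v : A → ℝ} → (∀ i → u i ≈ v i) → Bounded u → Bounded v
bounded-cong u≈v bu = bounded λ i →
  proj₁ (u≈v i) (proj₁ (within bu i)) , proj₂ (within bu i) ∘ proj₂ (u≈v i)

≤-bounded : ∀ {A : Set a} {u : A → ℝ} x y → (∀ i → x ≤ u i × u i ≤ y) → Bounded u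
≤-bounded x y x≤u≤y =
  let _ , p∈ = lower-inhabited x
      _ , q∈ = upper-inhabited y
  in  bounded λ i → proj₁ (x≤u≤y i) p∈ , upper⇒¬lower y q∈ ∘ proj₂ (x≤u≤y i)

mono-bounded : ∀ {A : Set a} {u : A → ℝ} C → Nondecreasing C → Bounded u → Bounded (λ i → C ⟨ u i ⟩)
mono-bounded {u = u} C C↗ (bounded {p} {q} w) = ≤-bounded (C ⟨ fromℚ p ⟩) (C ⟨ fromℚ q ⟩) λ i →
  C↗ {fromℚ p} {u i} (fromℚ-≤ (u i) (proj₁ (w i))) ,
  C↗ {u i} {fromℚ q} (≤-fromℚ (u i) (proj₂ (w i)))

anti-bounded : ∀ {A : Set a} {u : A → ℝ} D → Nonincreasing D → Bounded u → Bounded (λ i → D ⟨ u i ⟩)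
anti-bounded {u = u} D D↘ (bounded {p} {q} w) = ≤-bounded (D ⟨ fromℚ q ⟩) (D ⟨ fromℚ p ⟩) λ i →
  D↘ {u i} {fromℚ q} (≤-fromℚ (u i) (proj₂ (w i))) ,
  D↘ {fromℚ p} {u i} (fromℚ-≤ (u i) (proj₁ (w i)))

const-bounded : ∀ {A : Set a} r → Bounded {A = A} (λ _ → r)
const-bounded r = ≤-bounded r r λ _ → id , id

⊔-bounded : {A : Set a} {u v : A → ℝ} → Bounded u → Bounded v → Bounded (λ i → u i ⊔ v i)
⊔-bounded {u = u} {v} (bounded {top = q} w) (bounded {top = q′} w′) = bounded λ i →
  inj₁ (proj₁ (w i)) ,
  [ (λ l → proj₂ (w i) (lower-closed (u i) (ℚ.p≤p⊔q q q′) l))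
  , (λ l → proj₂ (w′ i) (lower-closed (v i) (ℚ.p≤q⊔p q q′) l)) ]′

⊓-bounded : {A : Set a} {u v : A → ℝ} → Bounded u → Bounded v → Bounded (λ i → u i ⊓ v i)
⊓-bounded {u = u} {v} (bounded {p} w) (bounded {p′} w′) = bounded λ i →
  lower-⊓⁺ (u i) (v i)
    (lower-closed (u i) (ℚ.p⊓q≤p p p′) (proj₁ (w i)))
    (lower-closed (v i) (ℚ.p⊓q≤q p p′) (proj₁ (w′ i))) ,
  proj₂ (w i) ∘ proj₁ ∘ lower-⊓⁻ (u i) (v i)

⊓₃-bounded : {A : Set a} {u v w : A → ℝ} → Bounded u → Bounded v → Bounded w →
  Bounded (λ i → u i ⊓ (v i ⊓ w i))
⊓₃-bounded {u = u} {v} {w} bu bv bw =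
  ⊓-bounded {u = u} {λ i → v i ⊓ w i} bu (⊓-bounded {u = v} {w} bv bw)

-- Classical principles and choice

module _ (em : EM) where
  open Classical em

  stable : {P : Set a} → ¬ ¬ P → P
  stable {P = P} ¬¬p with em {P = P}
  ... | yes p = p
  ... | no ¬p = ⊥-elim (¬¬p ¬p)

  ¬∀⇒∃¬ : {A : Set a} {P : Pred A ℓ} → ¬ (∀ x → P x) → ∃ λ x → ¬ P x
  ¬∀⇒∃¬ ¬∀ = stable λ ¬∃ → ¬∀ λ x → stable λ ¬p → ¬∃ (x , ¬p)

  -- Excluded middle decides each `∃ (P i)` and supplies the witness. The second clause fixes the
  -- point where there is none, which `fixed-glue` relies on.
  choose : ∀ {b} {I : Set ι} {A : I → Set a} (default : ∀ i → A i) (P : ∀ i → Pred (A i) b) →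
    ∃ λ (x : ∀ i → A i) → ∀ i → (∃ (P i) → P i (x i)) × (P i (x i) ⊎ x i ≡ default i)
  choose {I = I} {A} default P = proj₁ ∘ pick , proj₂ ∘ pick
    where
    pick : ∀ i → ∃ λ (x : A i) → (∃ (P i) → P i x) × (P i x ⊎ x ≡ default i)
    pick i with em {P = ∃ (P i)}
    ... | yes (x , p) = x , (λ _ → p) , inj₁ p
    ... | no ¬∃       = default i , (⊥-elim ∘ ¬∃) , inj₂ refl

  -- Suprema and infima

  -- True (em {P = P q}) is a copy of P q in the lowest universe.
  fromLower : (P : Pred ℚ a) → (∀ {q r} → q ℚ.≤ r → P r → P q) →
    (∀ {q} → P q → ∃ λ r → q ℚ.< r × P r) → ∃ P → ∃ (∁ P) →
    ∃ λ x → (∀ {q} → P q → lower x q) × (∀ {q} → lower x q → P q)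
  fromLower P closed rounded (p , p∈) (b , b∉) = record
    { lower = λ q → True (em {P = P q})
    ; upper = λ r → ∃ λ q → q ℚ.< r × ¬ True (em {P = P q})
    ; lower-inhabited = p , fromWitness p∈
    ; upper-inhabited = b ℚ.+ 1ℚ , b , p<p+1 b , b∉ ∘ toWitness
    ; lower-closed = λ q≤r l → fromWitness (closed q≤r (toWitness l))
    ; upper-closed = λ q≤r (p , p<q , ¬l) → p , ℚ.<-≤-trans p<q q≤r , ¬l
    ; lower-rounded = λ l → let r , q<r , r∈ = rounded (toWitness l) in r , q<r , fromWitness r∈
    ; upper-rounded = λ (p , p<r , ¬l) →
        let q , p<q , q<r = ℚ.<-dense p<r in q , q<r , p , p<q , ¬l
    ; lower<upper = λ {q} l (p , p<r , ¬l) → ℚ.<-trans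
        (ℚ.≰⇒> λ p≤q → ¬l (fromWitness (closed p≤q (toWitness l)))) p<r
    ; located = λ {q} q<r → [ inj₁ , (λ ¬l → inj₂ (q , q<r , ¬l)) ]′ (decide q)
    } , fromWitness , toWitness
    where
    decide : ∀ q → True (em {P = P q}) ⊎ ¬ True (em {P = P q})
    decide q with em {P = P q}
    ... | yes _ = inj₁ tt
    ... | no _  = inj₂ id

  module _ {A : Set a} (u : A → ℝ) (a₀ : A) (u-bounded : Bounded u) where

    ∃-sup : ∃ (IsSup u)
    ∃-sup =
      let z , to , from = fromLower (λ q → ∃ λ i → lower (u i) q)
            (λ q≤r (i , l) → i , lower-closed (u i) q≤r l)
            (λ (i , l) → let r , q<r , r∈ = lower-rounded (u i) l in r , q<r , i , r∈)
            (bottom u-bounded , a₀ , proj₁ (within u-bounded a₀))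
            (top u-bounded , λ (i , l) → proj₂ (within u-bounded i) l)
      in  z , (λ i l → to (i , l)) , λ w u≤w l → let i , l′ = from l in u≤w i l′

    ∃-inf : ∃ (IsInf u)
    ∃-inf =
      -- The intersection of the lower cuts need not be rounded; the `r` above `q` makes it so.
      let z , to , from = fromLower (λ q → ∃ λ r → q ℚ.< r × ∀ i → lower (u i) r)
            (λ q≤r (p , r<p , l) → p , ℚ.≤-<-trans q≤r r<p , l)
            (λ (p , q<p , l) → let r , q<r , r<p = ℚ.<-dense q<p in r , q<r , p , r<p , l)
            (_ , _ , p-1<p (bottom u-bounded) , proj₁ ∘ within u-bounded)
            (top u-bounded , λ (r , <r , l) →
              proj₂ (within u-bounded a₀) (lower-closed (u a₀) (ℚ.<⇒≤ <r) (l a₀)))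
      in  z , (λ i l → let r , q<r , l′ = from l in lower-closed (u i) (ℚ.<⇒≤ q<r) (l′ i))
            , λ w w≤u l → let r , q<r , r∈ = lower-rounded w l in to (r , q<r , λ i → w≤u i r∈)

    ⨆-isSup : IsSup u (⨆ u)
    ⨆-isSup with em {P = ∃ (IsSup u)}
    ... | yes (_ , isSup) = isSup
    ... | no ¬∃           = ⊥-elim (¬∃ ∃-sup)

    ⨅-isInf : IsInf u (⨅ u)
    ⨅-isInf with em {P = ∃ (IsInf u)}
    ... | yes (_ , isInf) = isInf
    ... | no ¬∃           = ⊥-elim (¬∃ ∃-inf)

    ⨆-lower⁺ : ∀ i {q} → lower (u i) q → lower (⨆ u) q
    ⨆-lower⁺ i = proj₁ ⨆-isSup i

    ⨆-lower⁻ : ∀ {q} → lower (⨆ u) q → ∃ λ i → lower (u i) q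
    ⨆-lower⁻ {q} l = stable λ ¬∃ →
      let p , q<p , p∈ = lower-rounded (⨆ u) l
          u≤q = proj₂ ⨆-isSup (fromℚ q) λ i → ≤-fromℚ (u i) λ l → ¬∃ (i , l)
      in  ℚ.<-asym q<p (u≤q p∈)

    ⨅-lower⁻ : ∀ {q} → lower (⨅ u) q → ∀ i → lower (u i) q
    ⨅-lower⁻ l i = proj₁ ⨅-isInf i l

    ⨅-lower⁺ : ∀ {q r} → q ℚ.< r → (∀ i → lower (u i) r) → lower (⨅ u) q
    ⨅-lower⁺ q<r l = proj₂ ⨅-isInf (fromℚ _) (λ i → fromℚ-≤ (u i) (l i)) q<r

    ¬⨅-lower : ∀ {q r} → q ℚ.< r → ¬ lower (⨅ u) q → ∃ λ i → ¬ lower (u i) r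
    ¬⨅-lower q<r ¬l = ¬∀⇒∃¬ (¬l ∘ ⨅-lower⁺ q<r)

  -- Families without a supremum are included: their ⨆ is the dummy 0ℝ.
  ⨆≤0 : {A : Set a} (u : A → ℝ) → (∀ i → u i ≤ 0ℝ) → ⨆ u ≤ 0ℝ
  ⨆≤0 u u≤0 with em {P = ∃ (IsSup u)}
  ... | yes (_ , isSup) = proj₂ isSup 0ℝ u≤0
  ... | no _            = id

  -- Stationary sets and limits superior

  module _ {I : Set ι} (F : Filter I f) where
    open Filter F

    Stationary : Pred (Pred I 0ℓ) f
    Stationary X = ¬ (∁ X ∈ᴾ sets)

    ¬Stationary⇒∁ : ∀ {X} → ¬ Stationary X → ∁ X ∈ᴾ sets
    ¬Stationary⇒∁ = stable

    Stationary-⊆ : ∀ {X Y} → X ⊆ Y → Stationary X → Stationary Y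
    Stationary-⊆ X⊆Y sX ∁Y∈ = sX (upward (λ i∉Y → i∉Y ∘ X⊆Y) ∁Y∈)

    Stationary-∩ : ∀ {X J} → J ∈ᴾ sets → Stationary X → Stationary (X ∩ J)
    Stationary-∩ J∈ sX ∁∈ = sX (upward (λ (i∉ , i∈J) i∈X → i∉ (i∈X , i∈J)) (inter ∁∈ J∈))

    Stationary-inhabited : ∀ {X} → Stationary X → ∃ X
    Stationary-inhabited sX = stable λ ¬∃ → sX (upward (λ _ i∈X → ¬∃ (_ , i∈X)) univ)

    Stationary-∩-inhabited : ∀ {X J} → J ∈ᴾ sets → Stationary X → ∃ (X ∩ J)
    Stationary-∩-inhabited J∈ sX = Stationary-inhabited (Stationary-∩ J∈ sX)

    Stationary-∪ : ∀ {X Y} → Stationary (X ∪ Y) → Stationary X ⊎ Stationary Y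
    Stationary-∪ {X} sX∪Y with em {P = Stationary X}
    ... | yes sX = inj₁ sX
    ... | no ¬sX = inj₂ λ ∁Y∈ →
      sX∪Y (upward (λ (i∉X , i∉Y) → [ i∉X , i∉Y ]′) (inter (¬Stationary⇒∁ ¬sX) ∁Y∈))

    sets-inhabited : ∀ {J} → J ∈ᴾ sets → ∃ J
    sets-inhabited J∈ = stable λ ¬∃ → proper (upward (λ i∈J → ¬∃ (_ , i∈J)) J∈)

    sets-∀ : ∀ {n} (X : Fin n → Pred I 0ℓ) → (∀ j → X j ∈ᴾ sets) → (λ i → ∀ j → X j i) ∈ᴾ sets
    sets-∀ {zero}  X X∈ = upward (λ _ ()) univ
    sets-∀ {suc n} X X∈ = upward (λ where (i∈ , _) zero → i∈ ; (_ , i∈) (suc j) → i∈ j)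
      (inter (X∈ zero) (sets-∀ (X ∘ suc) (X∈ ∘ suc)))

    Stationary-∃ : ∀ {n} (X : Fin n → Pred I 0ℓ) → Stationary (λ i → ∃ λ j → X j i) →
      ∃ λ j → Stationary (X j)
    Stationary-∃ X sX = stable λ ¬∃ → sX (upward (λ i∉ (j , i∈) → i∉ j i∈)
      (sets-∀ (∁ ∘ X) λ j → ¬Stationary⇒∁ λ s → ¬∃ (j , s)))

    -- The limit superior in terms of stationary sets, free of nested extrema. `above` needs its
    -- gap: if `u` decreases strictly to `q`, then `{q < u}` is stationary although `z = q`.
    record IsLimsup (u : I → ℝ) (z : ℝ) : Set f where
      field
        below : ∀ {q} → lower z q → Stationary (λ i → lower (u i) q)
        above : ∀ {q r} → q ℚ.< r → Stationary (λ i → lower (u i) r) → lower z q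

      eventually : ∀ {r} → upper z r → (λ i → ¬ lower (u i) r) ∈ᴾ sets
      eventually r∈ =
        let q , q<r , q∈ = upper-rounded z r∈
        in  ¬Stationary⇒∁ λ s → upper⇒¬lower z q∈ (above q<r s)

    open IsLimsup

    IsLimsup-cong : ∀ {u v z} → (∀ i → u i ≈ v i) → IsLimsup u z → IsLimsup v z
    IsLimsup-cong u≈v lim = record
      { below = λ l → Stationary-⊆ (λ {i} → proj₁ (u≈v i)) (below lim l)
      ; above = λ q<r s → above lim q<r (Stationary-⊆ (λ {i} → proj₂ (u≈v i)) s)
      }

    module _ {u : I → ℝ} (u-bounded : Bounded u) where
      private
        sup-on : ∃ sets → ℝ
        sup-on (J , _) = ⨆ {A = ∃ J} λ (i , _) → u i

        module OnSet (J : Pred I 0ℓ) (J∈ : J ∈ᴾ sets) where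
          u-on : ∃ J → ℝ
          u-on (i , _) = u i

          lower⁺ : ∀ {i q} → J i → lower (u i) q → lower (sup-on (J , J∈)) q
          lower⁺ i∈ l = ⨆-lower⁺ u-on (sets-inhabited J∈) (Bounded-∘ u-bounded proj₁) (_ , i∈) l

          lower⁻ : ∀ {q} → lower (sup-on (J , J∈)) q → ∃ λ i → J i × lower (u i) q
          lower⁻ l =
            let (i , i∈) , l′ = ⨆-lower⁻ u-on (sets-inhabited J∈) (Bounded-∘ u-bounded proj₁) l
            in  i , i∈ , l′

        sup-on-bounded : Bounded sup-on
        sup-on-bounded = bounded λ (J , J∈) →
          (let _ , i∈ = sets-inhabited J∈ in OnSet.lower⁺ J J∈ i∈ (proj₁ (within u-bounded _))) ,
          (λ l → let i , _ , l′ = OnSet.lower⁻ J J∈ l in proj₂ (within u-bounded i) l′)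

      -- A stationary set meets every `J` in `F`, which makes all the suprema large. Conversely, the
      -- complement of a nonstationary `{q < u}` is itself a `J` on which the supremum is at most
      -- `q`.
      limsup-isLimsup : IsLimsup u (limsup F u)
      limsup-isLimsup = record
        { below = λ l ∁∈ →
            let i , i∉ , l′ = OnSet.lower⁻ _ ∁∈ (⨅-lower⁻ sup-on (U , univ) sup-on-bounded l (_ , ∁∈))
            in  i∉ l′
        ; above = λ q<r s → ⨅-lower⁺ sup-on (U , univ) sup-on-bounded q<r λ (J , J∈) →
            let _ , l , i∈ = Stationary-∩-inhabited J∈ s in OnSet.lower⁺ J J∈ i∈ l
        }

      -- The strict lower bound may become an equality in the limit, so it is decreased by 1; the
      -- weak upper bound persists.
      limsup-bounded :
        lower (limsup F u) (bottom u-bounded ℚ.- 1ℚ) × ¬ lower (limsup F u) (top u-bounded)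
      limsup-bounded =
        above limsup-isLimsup (p-1<p _) (λ ∁∈ →
          let i , i∉ = sets-inhabited ∁∈ in i∉ (proj₁ (within u-bounded i))) ,
        (λ l → let i , l′ = Stationary-inhabited (below limsup-isLimsup l)
               in  proj₂ (within u-bounded i) l′)

    limsup-⊔ : ∀ {u v z w} → IsLimsup u z → IsLimsup v w → IsLimsup (λ i → u i ⊔ v i) (z ⊔ w)
    limsup-⊔ lim lim′ = record
      { below = [ Stationary-⊆ inj₁ ∘ below lim , Stationary-⊆ inj₂ ∘ below lim′ ]′
      ; above = λ q<r s → [ inj₁ ∘ above lim q<r , inj₂ ∘ above lim′ q<r ]′ (Stationary-∪ s)
      }

    -- Continuity replaces `z` by a rational strictly below or above it, which can be compared with
    -- `u i` on a stationary set or on a set of `F`.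
    limsup-mono : ∀ {u z} C → Nondecreasing C → IsLimsup u z → IsLimsup (λ i → C ⟨ u i ⟩) (C ⟨ z ⟩)
    limsup-mono {u} {z} C C↗ lim = record
      { below = λ l →
          let p , _ , p∈ , _ , l′ , _ = continuous-lower C z l
          in  Stationary-⊆ (λ {i} p∈u → C↗ {fromℚ p} {u i} (fromℚ-≤ (u i) p∈u) l′) (below lim p∈)
      ; above = λ {q} {r} q<r s → stable λ ¬l →
          let _ , p , _ , p∈ , _ , r∈ = continuous-upper C z (¬lower⇒upper (C ⟨ z ⟩) q<r ¬l)
              i , l , p∉u = Stationary-∩-inhabited (eventually lim p∈) s
          in  upper⇒¬lower (C ⟨ fromℚ p ⟩) r∈ (C↗ {u i} {fromℚ p} (≤-fromℚ (u i) p∉u) l)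
      }

    -- A nonincreasing D turns the limit superior into a limit inferior.
    module _ {u : I → ℝ} {z} (D : Unary) (D↘ : Nonincreasing D) (lim : IsLimsup u z) where

      liminf-below : ∀ {q} → lower (D ⟨ z ⟩) q → (λ i → lower (D ⟨ u i ⟩) q) ∈ᴾ sets
      liminf-below l =
        let _ , p , _ , p∈ , _ , l′ = continuous-lower D z l
        in  upward (λ {i} p∉u → D↘ {u i} {fromℚ p} (≤-fromℚ (u i) p∉u) l′) (eventually lim p∈)

      liminf-above : ∀ {q r} → q ℚ.< r → (λ i → lower (D ⟨ u i ⟩) r) ∈ᴾ sets → lower (D ⟨ z ⟩) q
      liminf-above q<r J∈ = stable λ ¬l →
        let p , _ , p∈ , _ , r∈ , _ = continuous-upper D z (¬lower⇒upper (D ⟨ z ⟩) q<r ¬l)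
            i , p∈u , l = Stationary-∩-inhabited J∈ (below lim p∈)
        in  upper⇒¬lower (D ⟨ fromℚ p ⟩) r∈ (D↘ {fromℚ p} {u i} (fromℚ-≤ (u i) p∈u) l)

    -- Quantifiers and clause (5) under limits superior

    module _ {A : I → Set a} (a₀ : ∀ i → A i) where

      module _ {φ : ∀ i → A i → ℝ} {Φ : (∀ i → A i) → ℝ}
        (φ-bounded : ∀ i → Bounded (φ i)) (Φ-bounded : Bounded Φ)
        (lim : ∀ x → IsLimsup (λ i → φ i (x i)) (Φ x)) where

        -- Near minimisers chosen in each coordinate form one point of the product, at which `Φ`
        -- would be too small if `below` failed.
        limsup-⨅ : IsLimsup (λ i → ⨅ (φ i)) (⨅ Φ)
        limsup-⨅ = record
          { below = λ l ∁∈ →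
              let r , q<r , r∈ = lower-rounded (⨅ Φ) l
                  x , x∈ = choose a₀ λ i x → ¬ lower (φ i x) r
              in  below (lim x) (⨅-lower⁻ Φ a₀ Φ-bounded r∈ x)
                    (upward (λ {i} ¬l → proj₁ (x∈ i) (¬⨅-lower (φ i) (a₀ i) (φ-bounded i) q<r ¬l)) ∁∈)
          ; above = λ {q} {r} q<r s →
              let p , q<p , p<r = ℚ.<-dense q<r
              in  ⨅-lower⁺ Φ a₀ Φ-bounded q<p λ x → above (lim x) p<r
                    (Stationary-⊆ (λ {i} l → ⨅-lower⁻ (φ i) (a₀ i) (φ-bounded i) l (x i)) s)
          }

        -- Dually, here it is `above` that glues coordinatewise witnesses into one point.
        limsup-⨆ : IsLimsup (λ i → ⨆ (φ i)) (⨆ Φ)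
        limsup-⨆ = record
          { below = λ l →
              let x , l′ = ⨆-lower⁻ Φ a₀ Φ-bounded l
              in  Stationary-⊆ (λ {i} → ⨆-lower⁺ (φ i) (a₀ i) (φ-bounded i) (x i)) (below (lim x) l′)
          ; above = λ {q} {r} q<r s →
              let x , x∈ = choose a₀ λ i x → lower (φ i x) r
              in  ⨆-lower⁺ Φ a₀ Φ-bounded x (above (lim x) q<r (Stationary-⊆
                    (λ {i} l → proj₁ (x∈ i) (⨆-lower⁻ (φ i) (a₀ i) (φ-bounded i) l)) s))
          }

      module _ {φ ψ χ : ∀ i → A i → ℝ} {Φ Ψ Χ : (∀ i → A i) → ℝ} (D : Unary) (Δ : ℝ)
        (D↘ : Nonincreasing D) (fix : D ⟨ Δ ⟩ ≈ Δ)
        (χ≈ : ∀ i x → χ i x ≈ D ⟨ φ i x ⟩ ⊓ (Δ ⊓ ψ i x))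
        (Χ≈ : ∀ x → Χ x ≈ D ⟨ Φ x ⟩ ⊓ (Δ ⊓ Ψ x))
        (φ-bounded : ∀ i → Bounded (φ i)) (Φ-bounded : Bounded Φ)
        (χ-bounded : ∀ i → Bounded (χ i)) (Χ-bounded : Bounded Χ)
        (limφ : ∀ x → IsLimsup (λ i → φ i (x i)) (Φ x))
        (limψ : ∀ x → IsLimsup (λ i → ψ i (x i)) (Ψ x)) where
        private
          χ⁻ : ∀ i x {q} → lower (χ i x) q →
            lower (D ⟨ φ i x ⟩) q × lower Δ q × lower (ψ i x) q
          χ⁻ i x = lower-⊓₃⁻ (D ⟨ φ i x ⟩) Δ (ψ i x) ∘ proj₁ (χ≈ i x)

          lim-inf : IsLimsup (λ i → ⨅ (φ i)) (⨅ Φ)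
          lim-inf = limsup-⨅ φ-bounded Φ-bounded limφ

        -- `D φ` exceeds `q` on a set of `F` and `ψ` on a stationary set, so both do on a stationary
        -- set.
        fixed-below : ∀ {q} → lower (⨆ Χ) q → Stationary (λ i → lower (⨆ (χ i)) q)
        fixed-below l =
          let x , l′ = ⨆-lower⁻ Χ a₀ Χ-bounded l
              lD , lΔ , lΨ = lower-⊓₃⁻ (D ⟨ Φ x ⟩) Δ (Ψ x) (proj₁ (Χ≈ x) l′)
          in  Stationary-⊆
                (λ {i} (lψ , lDφ) → ⨆-lower⁺ (χ i) (a₀ i) (χ-bounded i) (x i)
                  (proj₂ (χ≈ i (x i)) (lower-⊓₃⁺ (D ⟨ φ i (x i) ⟩) Δ (ψ i (x i)) lDφ lΔ lψ)))
                (Stationary-∩ (liminf-below D D↘ (limφ x) lD) (below (limψ x) lΨ))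

        -- The point is a witness of `r < χ` where there is one and `y` elsewhere. Then `D φ`
        -- exceeds `r` on a whole set of `F`, as a limit inferior demands, while for `ψ` the
        -- stationary set suffices.
        fixed-glue : ∀ {q r p} → q ℚ.< r → lower Δ r → lower Δ p →
          (y : ∀ i → A i) → (λ i → ¬ lower (φ i (y i)) p) ∈ᴾ sets →
          Stationary (λ i → lower (⨆ (χ i)) r) → lower (⨆ Χ) q
        fixed-glue {q} {r} {p} q<r rΔ pΔ y J∈ s =
          ⨆-lower⁺ Χ a₀ Χ-bounded x (proj₂ (Χ≈ x) (lower-⊓₃⁺ (D ⟨ Φ x ⟩) Δ (Ψ x)
            (liminf-above D D↘ (limφ x) q<r (upward (λ {i} → Dφ i) J∈))
            (lower-closed Δ (ℚ.<⇒≤ q<r) rΔ)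
            (above (limψ x) q<r (Stationary-⊆ (λ {i} → lψ i) s))))
          where
          glued = choose y λ i x → lower (χ i x) r
          x = proj₁ glued

          Dφ : ∀ i → ¬ lower (φ i (y i)) p → lower (D ⟨ φ i (x i) ⟩) r
          Dφ i p∉ with proj₂ (proj₂ glued i)
          ... | inj₁ l   = proj₁ (χ⁻ i (x i) l)
          -- Here `φ ≤ p < Δ`, so `D φ ≥ D Δ = Δ > r`.
          ... | inj₂ x≡y = subst (λ t → lower (D ⟨ φ i t ⟩) r) (sym x≡y)
            (D↘ {φ i (y i)} {Δ} (fromℚ-≤ Δ pΔ ∘ ≤-fromℚ (φ i (y i)) p∉) (proj₂ fix rΔ))

          lψ : ∀ i → lower (⨆ (χ i)) r → lower (ψ i (x i)) r
          lψ i l = proj₂ (proj₂ (χ⁻ i (x i)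
            (proj₁ (proj₂ glued i) (⨆-lower⁻ (χ i) (a₀ i) (χ-bounded i) l))))

        -- Off the stationary set where χ exceeds r, take a near minimiser of φ: if ⨅ Φ < Δ it
        -- makes φ smaller than Δ, hence D φ at least Δ, so that D φ exceeds r eventually.
        fixed-above : ∀ {q r} → q ℚ.< r → ¬ lower (⨅ Φ) q →
          Stationary (λ i → lower (⨆ (χ i)) r) → lower (⨆ Χ) q
        fixed-above {q} {r} q<r ¬l s with Stationary-inhabited s
        ... | i , l with ⨆-lower⁻ (χ i) (a₀ i) (χ-bounded i) l
        -- As `χ ≤ Δ`, a single coordinate with `χ > r` gives `r < Δ`, and `p` is taken in between.
        ... | x , l′ with lower-rounded Δ (proj₁ (proj₂ (χ⁻ i x l′)))
        ... | p , r<p , pΔ =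
          fixed-glue q<r (proj₁ (proj₂ (χ⁻ i x l′))) pΔ (proj₁ minimisers)
            (upward (λ {i} ¬l → proj₁ (proj₂ minimisers i)
                (¬⨅-lower (φ i) (a₀ i) (φ-bounded i) r<p ¬l))
              (¬Stationary⇒∁ λ s → ¬l (above lim-inf q<r s)))
            s
          where
          minimisers = choose a₀ λ i x → ¬ lower (φ i x) p

        limsup-fixed : IsLimsup (λ i → ⨅ (φ i) ⊔ ⨆ (χ i)) (⨅ Φ ⊔ ⨆ Χ)
        limsup-fixed = record
          { below = [ Stationary-⊆ inj₁ ∘ below lim-inf , Stationary-⊆ inj₂ ∘ fixed-below ]′
          ; above = λ {q} {r} q<r s → [ inj₁ ∘ above lim-inf q<r , sup-above q<r ]′ (Stationary-∪ s)
          }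
          where
          sup-above : ∀ {q r} → q ℚ.< r → Stationary (λ i → lower (⨆ (χ i)) r) →
            lower (⨅ Φ ⊔ ⨆ Χ) q
          sup-above {q} q<r s with em {P = lower (⨅ Φ) q}
          ... | yes l = inj₁ l
          ... | no ¬l = inj₂ (fixed-above q<r ¬l s)

    -- Splitting stationary sets

    Splitting : Set (lsuc 0ℓ ⊔ˡ ι ⊔ˡ f)
    Splitting = ∀ {X} → Stationary X →
      ∃ λ (A : Pred I 0ℓ) → Stationary (X ∩ A) × Stationary (X ∩ ∁ A)

    -- The class of `X` in the algebra is nonzero because `X` is stationary. Were `X` unsplittable,
    -- its class would be an atom: an element `y` below it cuts `X` in two, and one of the halves is
    -- negligible.
    atomless⇒splitting : Atomless (𝟚^ F) → Splitting
    atomless⇒splitting atomless {X} sX = stable λ ¬split → atomless χ (χ≉⊥ , minimal ¬split)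
      where
      χ : I → Bool
      χ i = isYes (em {P = X i})

      χ≉⊥ : ¬ ((λ i → χ i ≡ false) ∈ᴾ sets)
      χ≉⊥ χ≈⊥ = sX (upward (λ {i} → ∉X (em {P = X i})) χ≈⊥)
        where
        ∉X : ∀ {P : Set} (P? : Dec P) → isYes P? ≡ false → ¬ P
        ∉X (no ¬p) _ = ¬p

      ∧-false : ∀ {P : Set} (P? : Dec P) b → ¬ (P × b ≡ true) → b ≡ b ∧ isYes P? → b ≡ false
      ∧-false _       false _    _ = refl
      ∧-false (yes p) true  disj _ = ⊥-elim (disj (p , refl))

      ∧-self : ∀ {P : Set} (P? : Dec P) b → ¬ (P × ¬ b ≡ true) → b ≡ b ∧ isYes P? → b ≡ isYes P?
      ∧-self _       true  _   e = e
      ∧-self (yes p) false sub _ = ⊥-elim (sub (p , λ ()))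
      ∧-self (no _)  false _   _ = refl

      minimal : ¬ (∃ λ (A : Pred I 0ℓ) → Stationary (X ∩ A) × Stationary (X ∩ ∁ A)) →
        ∀ y → (λ i → y i ≡ y i ∧ χ i) ∈ᴾ sets →
        (λ i → y i ≡ false) ∈ᴾ sets ⊎ (λ i → y i ≡ χ i) ∈ᴾ sets
      -- If the half where `y` is true is negligible, `y` is zero; otherwise the other half is, and
      -- `y` equals `χ`.
      minimal ¬split y y≤χ with em {P = Stationary (X ∩ λ i → y i ≡ true)}
      ... | no ¬s = inj₁ (upward (λ {i} (disj , e) → ∧-false (em {P = X i}) (y i) disj e)
        (inter (¬Stationary⇒∁ ¬s) y≤χ))
      ... | yes s = inj₂ (upward (λ {i} (sub , e) → ∧-self (em {P = X i}) (y i) sub e)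
        (inter (¬Stationary⇒∁ λ s′ → ¬split (_ , s , s′)) y≤χ))

    module _ (splitting : Splitting) where

      -- Each `T j` costs one splitting. If removing the first half leaves nothing stationary of
      -- `T j`, then `T j` lies in that half up to `F`, and removing the second half spares it.
      shrink : ∀ {n X} → Stationary X → (T : Fin n → Pred I 0ℓ) → (∀ j → Stationary (T j)) →
        ∃ λ (A : Pred I 0ℓ) → A ⊆ X × Stationary A × ∀ j → Stationary (T j ∩ ∁ A)
      shrink {zero} {X} sX T sT = X , id , sX , λ ()
      shrink {suc n} sX T sT with shrink sX (T ∘ suc) (sT ∘ suc)
      ... | A , A⊆X , sA , rest with splitting sA
      ... | B , s₁ , s₂ with em {P = Stationary (T zero ∩ ∁ (A ∩ B))}
      ... | yes s = A ∩ B , A⊆X ∘ proj₁ , s₁ , λ where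
        zero    → s
        (suc j) → Stationary-⊆ (λ (i∈T , i∉A) → i∈T , i∉A ∘ proj₁) (rest j)
      ... | no ¬s = A ∩ ∁ B , A⊆X ∘ proj₁ , s₂ , λ where
        zero    → Stationary-⊆
          (λ (i∈T , i∉) → i∈T , λ (i∈A , i∉B) → i∉ (i∈T , i∉B ∘ proj₂))
          (Stationary-∩ (¬Stationary⇒∁ ¬s) (sT zero))
        (suc j) → Stationary-⊆ (λ (i∈T , i∉A) → i∈T , i∉A ∘ proj₁) (rest j)

      -- Disjoint stationary parts of the `T j`, encoded as a total colouring so that every
      -- coordinate knows which witness to copy. `shrink` reserves a part of the first set and
      -- leaves the others stationary.
      colouring : ∀ {n} (T : Fin (suc n) → Pred I 0ℓ) → (∀ j → Stationary (T j)) →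
        ∃ λ (c : I → Fin (suc n)) → ∀ j → Stationary (λ i → c i ≡ j × T j i)
      colouring {zero} T sT = (λ _ → zero) , λ where zero → Stationary-⊆ (refl ,_) (sT zero)
      colouring {suc n} T sT with shrink (sT zero) (T ∘ suc) (sT ∘ suc)
      ... | A , A⊆T , sA , rest with colouring (λ j → T (suc j) ∩ ∁ A) rest
      ... | c , c∈ = (λ i → extend i (em {P = A i})) , λ where
          zero    → Stationary-⊆ (λ {i} i∈A → extend-∈ i (em {P = A i}) i∈A , A⊆T i∈A) sA
          (suc j) → Stationary-⊆
            (λ {i} (e , i∈T , i∉A) → trans (extend-∉ i (em {P = A i}) i∉A) (cong suc e) , i∈T) (c∈ j)
        where
        extend : ∀ i → Dec (A i) → Fin (suc (suc n))
        extend i (yes _) = zero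
        extend i (no _)  = suc (c i)

        extend-∈ : ∀ i A? → A i → extend i A? ≡ zero
        extend-∈ i (yes _)  _   = refl
        extend-∈ i (no i∉A) i∈A = ⊥-elim (i∉A i∈A)

        extend-∉ : ∀ i A? → ¬ A i → extend i A? ≡ suc (c i)
        extend-∉ i (yes i∈A) i∉A = ⊥-elim (i∉A i∈A)
        extend-∉ i (no _)    _   = refl

  -- Palyutin formulas in reduced products

  module _ {L : Signature s} (N : RawStructure L ℓ) where
    open RawStructure N using (Carrier; d) renaming (rel to relᴺ)

    -- The common ground of the factors and of the reduced product, which is given as a raw
    -- structure.
    record IsBounded : Set (s ⊔ˡ ℓ) where
      field
        point : Carrier
        dist-bounded : Bounded {A = Carrier × Carrier} λ (x , y) → d x y
        rel-bounded : ∀ p → Bounded (relᴺ p)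

  module _ {L : Signature s} {N : RawStructure L ℓ} (N-bounded : IsBounded N) where
    open RawStructure N using (Carrier; d) renaming (rel to relᴺ)
    open IsBounded N-bounded

    inf-bounded : ∀ {n} {φ : Formula L (suc n)} → Bounded (⟦_⟧ N φ) → Bounded (⟦_⟧ N (inf φ))
    inf-bounded φᵇ = bounded λ v →
      ⨅-lower⁺ _ point (Bounded-∘ φᵇ (_∷ᵛ v)) (p-1<p _) (λ x → proj₁ (within φᵇ (x ∷ᵛ v))) ,
      (λ l → proj₂ (within φᵇ (point ∷ᵛ v)) (⨅-lower⁻ _ point (Bounded-∘ φᵇ (_∷ᵛ v)) l point))

    sup-bounded : ∀ {n} {φ : Formula L (suc n)} → Bounded (⟦_⟧ N φ) → Bounded (⟦_⟧ N (sup φ))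
    sup-bounded φᵇ = bounded λ v →
      ⨆-lower⁺ _ point (Bounded-∘ φᵇ (_∷ᵛ v)) point (proj₁ (within φᵇ (point ∷ᵛ v))) ,
      (λ l → let x , l′ = ⨆-lower⁻ _ point (Bounded-∘ φᵇ (_∷ᵛ v)) l in proj₂ (within φᵇ (x ∷ᵛ v)) l′)

    fixed-bounded : ∀ {n} {φ ψ : Formula L n} D Δ → Nonincreasing D →
      Bounded (⟦_⟧ N φ) → Bounded (⟦_⟧ N ψ) → Bounded (⟦_⟧ N (minᶠ (D · φ) (minᶠ (constᶠ Δ) ψ)))
    fixed-bounded {φ = φ} {ψ} D Δ D↘ φᵇ ψᵇ = bounded-cong
      {u = λ v → D ⟨ ⟦_⟧ N φ v ⟩ ⊓ (Δ ⊓ ⟦_⟧ N ψ v)} {⟦_⟧ N (minᶠ (D · φ) (minᶠ (constᶠ Δ) ψ))}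
      (λ v → id , id)
      (⊓₃-bounded {u = λ v → D ⟨ ⟦_⟧ N φ v ⟩} {λ _ → Δ} {⟦_⟧ N ψ}
        (anti-bounded {u = ⟦_⟧ N φ} D D↘ φᵇ) (const-bounded Δ) ψᵇ)

    -- Guarantees that the `⨆` and `⨅` met in evaluating Palyutin formulas are genuine extrema and
    -- not the dummy value.
    palyutin-bounded : ∀ {n} {φ : Formula L n} → Palyutin φ → Bounded (⟦_⟧ N φ)
    palyutin-bounded (rel p t) = Bounded-∘ (rel-bounded p) λ v k → ⟦_⟧ᵗ N (t k) v
    palyutin-bounded (dist t u) = Bounded-∘ dist-bounded λ v → ⟦_⟧ᵗ N t v , ⟦_⟧ᵗ N u v
    palyutin-bounded (mono {φ = φ} C C↗ P) = mono-bounded {u = ⟦_⟧ N φ} C C↗ (palyutin-bounded P)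
    palyutin-bounded (max {φ = φ} {ψ} P Q) =
      ⊔-bounded {u = ⟦_⟧ N φ} {⟦_⟧ N ψ} (palyutin-bounded P) (palyutin-bounded Q)
    palyutin-bounded (inf {φ = φ} P) = inf-bounded {φ = φ} (palyutin-bounded P)
    palyutin-bounded (sup {φ = φ} P) = sup-bounded {φ = φ} (palyutin-bounded P)
    palyutin-bounded (fixed {φ = φ} {ψ} D Δ D↘ _ P Q) =
      ⊔-bounded {u = ⟦_⟧ N (inf φ)} {⟦_⟧ N (sup χ)} (inf-bounded {φ = φ} (palyutin-bounded P))
        (sup-bounded {φ = χ}
          (fixed-bounded {φ = φ} {ψ} D Δ D↘ (palyutin-bounded P) (palyutin-bounded Q)))
      where χ = minᶠ (D · φ) (minᶠ (constᶠ Δ) ψ)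

  open Structure using (raw)

  -- Points at distance 0

  module _ {L : Signature s} (M : Structure L ℓ) where
    private module M = Structure M
    open Signature L
    open M using (Carrier)

    structure-bounded : IsBounded (raw M)
    structure-bounded = record
      { point = M.nonempty
      ; dist-bounded = ≤-bounded 0ℝ diameter λ (x , y) → M.d-nonneg x y , M.d-bounded x y
      ; rel-bounded = λ p → ≤-bounded (lowerBound p) (upperBound p) (M.rel-bounded p)
      }

    infix 4 _≃_

    -- Equality in the metric space meant; distances being nonnegative, one inequality suffices.
    _≃_ : Carrier → Carrier → Set
    x ≃ y = M.d x y ≤ 0ℝ

    ≃-refl : ∀ x → x ≃ x
    ≃-refl x = proj₁ (M.d-refl x)

    ≃-sym : ∀ x y → x ≃ y → y ≃ x
    ≃-sym x y x≃y l = x≃y (proj₂ (M.d-sym x y) l)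

    -- Points at distance 0 are within every modulus, so the images are within every `ε`.
    fun-cong : ∀ g u v → (∀ k → u k ≃ v k) → M.fun g u ≃ M.fun g v
    fun-cong g u v u≃v = arbitrarilySmall⇒≤0 (M.d (M.fun g u) (M.fun g v)) λ ε 0<ε →
      M.fun-uniform g (ε , 0<ε) u v λ k →
        ≤0⇒< (M.d (u k) (v k)) (proj₁ (modulusᶠ g (ε , 0<ε))) (u≃v k) (proj₂ (modulusᶠ g (ε , 0<ε)))

    rel-mono : ∀ p u v → (∀ k → u k ≃ v k) → M.rel p u ≤ M.rel p v
    rel-mono p u v u≃v = ∣-∣-small⇒≤ (M.rel p u) (M.rel p v) λ ε 0<ε →
      M.rel-uniform p (ε , 0<ε) u v λ k →
        ≤0⇒< (M.d (u k) (v k)) (proj₁ (modulusᴿ p (ε , 0<ε))) (u≃v k) (proj₂ (modulusᴿ p (ε , 0<ε)))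

    rel-cong : ∀ p u v → (∀ k → u k ≃ v k) → M.rel p u ≈ M.rel p v
    rel-cong p u v u≃v = rel-mono p u v u≃v , rel-mono p v u λ k → ≃-sym (u k) (v k) (u≃v k)

    d-mono : ∀ x x′ y y′ → x ≃ x′ → y ≃ y′ → M.d x y ≤ M.d x′ y′
    d-mono x x′ y y′ x≃x′ y≃y′ =
      ≤0⇒+-≤ʳ (M.d x′ y′) (M.d y′ y) (≃-sym y y′ y≃y′) ∘ M.d-triangle x′ y′ y ∘
      ≤0⇒+-≤ (M.d x x′) (M.d x′ y) x≃x′ ∘ M.d-triangle x x′ y

    d-cong : ∀ x x′ y y′ → x ≃ x′ → y ≃ y′ → M.d x y ≈ M.d x′ y′
    d-cong x x′ y y′ x≃x′ y≃y′ =
      d-mono x x′ y y′ x≃x′ y≃y′ , d-mono x′ x y′ y (≃-sym x x′ x≃x′) (≃-sym y y′ y≃y′)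

  module _ {L : Signature s} {I : Set ι} (M : I → Structure L ℓ) (F : Filter I f) where
    private
      module M i = Structure (M i)
      Mᶠ = reducedProduct M F
    open Signature L
    open IsBounded

    ∏ : Set (ι ⊔ˡ ℓ)
    ∏ = ∀ i → M.Carrier i

    reducedProduct-bounded : IsBounded Mᶠ
    reducedProduct-bounded = record
      { point = M.nonempty
      ; dist-bounded = bounded λ (x , y) → limsup-bounded F
          (≤-bounded {u = λ i → M.d i (x i) (y i)} 0ℝ diameter
            λ i → M.d-nonneg i (x i) (y i) , M.d-bounded i (x i) (y i))
      ; rel-bounded = λ p → bounded λ x → limsup-bounded F
          (≤-bounded {u = λ i → M.rel i p (λ k → x k i)} (lowerBound p) (upperBound p)
            λ i → M.rel-bounded i p (λ k → x k i))
      }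

    -- Coordinatewise agreement; it is kept separate from w i = λ k → v k i because valuations
    -- are functions and x ∷ᵛ v does not commute definitionally with taking coordinates.
    Agree : ∀ {n} → Vector ∏ n → (∀ i → Vector (M.Carrier i) n) → Set ι
    Agree v w = ∀ i k → _≃_ (M i) (v k i) (w i k)

    Agree-∷ : ∀ {n} {v : Vector ∏ n} {w} → Agree v w → ∀ x → Agree (x ∷ᵛ v) (λ i → x i ∷ᵛ w i)
    Agree-∷ v≃w x i zero    = ≃-refl (M i) (x i)
    Agree-∷ v≃w x i (suc k) = v≃w i k

    term-agree : ∀ {n} {v : Vector ∏ n} {w} → Agree v w → (t : Term L n) → ∀ i →
      _≃_ (M i) (⟦_⟧ᵗ Mᶠ t v i) (⟦_⟧ᵗ (raw (M i)) t (w i))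
    term-agree v≃w (var k)   i = v≃w i k
    term-agree v≃w (fun g t) i = fun-cong (M i) g _ _ λ k → term-agree v≃w (t k) i

    ValueIsLimsup : ∀ {n} → Formula L n → Vector ∏ n → (∀ i → Vector (M.Carrier i) n) → Set f
    ValueIsLimsup φ v w = IsLimsup F (λ i → ⟦_⟧ (raw (M i)) φ (w i)) (⟦_⟧ Mᶠ φ v)

    -- χ is the minimum in clause (5); as a variable it keeps Agda from comparing unfolded cuts, which
    -- is very slow.
    fixed-limsup : ∀ {n} (φ ψ χ : Formula L (suc n)) D Δ → Nonincreasing D → D ⟨ Δ ⟩ ≈ Δ →
      (∀ i v → ⟦_⟧ (raw (M i)) χ v ≈ D ⟨ ⟦_⟧ (raw (M i)) φ v ⟩ ⊓ (Δ ⊓ ⟦_⟧ (raw (M i)) ψ v)) →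
      (∀ v → ⟦_⟧ Mᶠ χ v ≈ D ⟨ ⟦_⟧ Mᶠ φ v ⟩ ⊓ (Δ ⊓ ⟦_⟧ Mᶠ ψ v)) →
      (∀ i → Bounded (⟦_⟧ (raw (M i)) φ)) → Bounded (⟦_⟧ Mᶠ φ) →
      (∀ i → Bounded (⟦_⟧ (raw (M i)) χ)) → Bounded (⟦_⟧ Mᶠ χ) →
      ∀ v w → (∀ x → ValueIsLimsup φ (x ∷ᵛ v) (λ i → x i ∷ᵛ w i)) →
      (∀ x → ValueIsLimsup ψ (x ∷ᵛ v) (λ i → x i ∷ᵛ w i)) →
      ValueIsLimsup (maxᶠ (inf φ) (sup χ)) v w
    fixed-limsup φ ψ χ D Δ D↘ fix χᴹ≈ χᶠ≈ φᴹ-bounded φᶠ-bounded χᴹ-bounded χᶠ-bounded v w limφ limψ =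
      limsup-fixed F M.nonempty
        {λ i x → ⟦_⟧ (raw (M i)) φ (x ∷ᵛ w i)}
        {λ i x → ⟦_⟧ (raw (M i)) ψ (x ∷ᵛ w i)}
        {λ i x → ⟦_⟧ (raw (M i)) χ (x ∷ᵛ w i)}
        {λ x → ⟦_⟧ Mᶠ φ (x ∷ᵛ v)} {λ x → ⟦_⟧ Mᶠ ψ (x ∷ᵛ v)} {λ x → ⟦_⟧ Mᶠ χ (x ∷ᵛ v)}
        D Δ D↘ fix (λ i x → χᴹ≈ i (x ∷ᵛ w i)) (λ x → χᶠ≈ (x ∷ᵛ v))
        (λ i → Bounded-∘ (φᴹ-bounded i) (_∷ᵛ w i)) (Bounded-∘ φᶠ-bounded (_∷ᵛ v))
        (λ i → Bounded-∘ (χᴹ-bounded i) (_∷ᵛ w i)) (Bounded-∘ χᶠ-bounded (_∷ᵛ v))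
        limφ limψ

    -- A Łoś theorem for Palyutin formulas, by induction on their formation. The atomic case is the
    -- definition of the reduced product; each other clause has its own limit lemma.
    palyutin-limsup : ∀ {n} {φ : Formula L n} → Palyutin φ → ∀ v w → Agree v w → ValueIsLimsup φ v w
    palyutin-limsup (rel p t) v w v≃w = IsLimsup-cong F {u} {u′} {limsup F u}
      (λ i → rel-cong (M i) p (λ k → ⟦_⟧ᵗ Mᶠ (t k) v i) (λ k → ⟦_⟧ᵗ (raw (M i)) (t k) (w i))
        λ k → term-agree v≃w (t k) i)
      (limsup-isLimsup F {u} (≤-bounded {u = u} (lowerBound p) (upperBound p)
        λ i → M.rel-bounded i p (λ k → ⟦_⟧ᵗ Mᶠ (t k) v i)))
      where
      u u′ : I → ℝ
      u i = M.rel i p λ k → ⟦_⟧ᵗ Mᶠ (t k) v i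
      u′ i = M.rel i p λ k → ⟦_⟧ᵗ (raw (M i)) (t k) (w i)
    palyutin-limsup (dist t t′) v w v≃w = IsLimsup-cong F {u} {u′} {limsup F u}
      (λ i → d-cong (M i) (⟦_⟧ᵗ Mᶠ t v i) (⟦_⟧ᵗ (raw (M i)) t (w i))
        (⟦_⟧ᵗ Mᶠ t′ v i) (⟦_⟧ᵗ (raw (M i)) t′ (w i)) (term-agree v≃w t i) (term-agree v≃w t′ i))
      (limsup-isLimsup F {u} (≤-bounded {u = u} 0ℝ diameter
        λ i → M.d-nonneg i (⟦_⟧ᵗ Mᶠ t v i) (⟦_⟧ᵗ Mᶠ t′ v i)
            , M.d-bounded i (⟦_⟧ᵗ Mᶠ t v i) (⟦_⟧ᵗ Mᶠ t′ v i)))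
      where
      u u′ : I → ℝ
      u i = M.d i (⟦_⟧ᵗ Mᶠ t v i) (⟦_⟧ᵗ Mᶠ t′ v i)
      u′ i = M.d i (⟦_⟧ᵗ (raw (M i)) t (w i)) (⟦_⟧ᵗ (raw (M i)) t′ (w i))
    palyutin-limsup (mono {φ = φ} C C↗ P) v w v≃w =
      limsup-mono F {λ i → ⟦_⟧ (raw (M i)) φ (w i)} {⟦_⟧ Mᶠ φ v} C C↗ (palyutin-limsup P v w v≃w)
    palyutin-limsup (max {φ = φ} {ψ} P Q) v w v≃w =
      limsup-⊔ F {λ i → ⟦_⟧ (raw (M i)) φ (w i)} {λ i → ⟦_⟧ (raw (M i)) ψ (w i)}
        {⟦_⟧ Mᶠ φ v} {⟦_⟧ Mᶠ ψ v}
        (palyutin-limsup P v w v≃w) (palyutin-limsup Q v w v≃w)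
    palyutin-limsup (inf {φ = φ} P) v w v≃w = limsup-⨅ F M.nonempty
      {λ i x → ⟦_⟧ (raw (M i)) φ (x ∷ᵛ w i)} {λ x → ⟦_⟧ Mᶠ φ (x ∷ᵛ v)}
      (λ i → Bounded-∘ (palyutin-bounded (structure-bounded (M i)) P) (_∷ᵛ w i))
      (Bounded-∘ (palyutin-bounded reducedProduct-bounded P) (_∷ᵛ v))
      λ x → palyutin-limsup P (x ∷ᵛ v) (λ i → x i ∷ᵛ w i) (Agree-∷ v≃w x)
    palyutin-limsup (sup {φ = φ} P) v w v≃w = limsup-⨆ F M.nonempty
      {λ i x → ⟦_⟧ (raw (M i)) φ (x ∷ᵛ w i)} {λ x → ⟦_⟧ Mᶠ φ (x ∷ᵛ v)}
      (λ i → Bounded-∘ (palyutin-bounded (structure-bounded (M i)) P) (_∷ᵛ w i))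
      (Bounded-∘ (palyutin-bounded reducedProduct-bounded P) (_∷ᵛ v))
      λ x → palyutin-limsup P (x ∷ᵛ v) (λ i → x i ∷ᵛ w i) (Agree-∷ v≃w x)
    palyutin-limsup (fixed {φ = φ} {ψ} D Δ D↘ fix P Q) v w v≃w =
      fixed-limsup φ ψ (minᶠ (D · φ) (minᶠ (constᶠ Δ) ψ)) D Δ D↘ fix
        (λ i v → id , id) (λ v → id , id)
        (λ i → palyutin-bounded (structure-bounded (M i)) P)
        (palyutin-bounded reducedProduct-bounded P)
        (λ i → fixed-bounded (structure-bounded (M i)) {φ = φ} {ψ} D Δ D↘
          (palyutin-bounded (structure-bounded (M i)) P)
          (palyutin-bounded (structure-bounded (M i)) Q))
        (fixed-bounded reducedProduct-bounded {φ = φ} {ψ} D Δ D↘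
          (palyutin-bounded reducedProduct-bounded P) (palyutin-bounded reducedProduct-bounded Q))
        v w
        (λ x → palyutin-limsup P (x ∷ᵛ v) (λ i → x i ∷ᵛ w i) (Agree-∷ v≃w x))
        (λ x → palyutin-limsup Q (x ∷ᵛ v) (λ i → x i ∷ᵛ w i) (Agree-∷ v≃w x))

  -- The conditions of SCP

  infixr 5 _⊹_

  -- Concatenation by recursion on the prefix, so that it follows the quantifiers of inf⋆.
  _⊹_ : {A : Set a} → ∀ {k m} → Vector A k → Vector A m → Vector A (k ℕ.+ m)
  _⊹_ {k = zero}  xs y = y
  _⊹_ {k = suc k} xs y = xs zero ∷ᵛ ((xs ∘ suc) ⊹ y)

  module _ {L : Signature s} {N : RawStructure L ℓ} where
    open RawStructure N using (Carrier)

    Max-lower⁺ : ∀ {n k} (φ : Vector (Formula L n) (suc k)) v j {q} →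
      lower (⟦_⟧ N (φ j) v) q → lower (⟦_⟧ N (Maxᶠ φ) v) q
    Max-lower⁺ {k = zero}  φ v zero    l = l
    Max-lower⁺ {k = suc k} φ v zero    l = inj₁ l
    Max-lower⁺ {k = suc k} φ v (suc j) l = inj₂ (Max-lower⁺ (φ ∘ suc) v j l)

    Max-lower⁻ : ∀ {n k} (φ : Vector (Formula L n) (suc k)) v {q} →
      lower (⟦_⟧ N (Maxᶠ φ) v) q → ∃ λ j → lower (⟦_⟧ N (φ j) v) q
    Max-lower⁻ {k = zero}  φ v l        = zero , l
    Max-lower⁻ {k = suc k} φ v (inj₁ l) = zero , l
    Max-lower⁻ {k = suc k} φ v (inj₂ l) = let j , l′ = Max-lower⁻ (φ ∘ suc) v l in suc j , l′

    Max-bounded : ∀ {n k} (φ : Vector (Formula L n) (suc k)) → (∀ j → Bounded (⟦_⟧ N (φ j))) →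
      Bounded (⟦_⟧ N (Maxᶠ φ))
    Max-bounded {k = zero}  φ φᵇ = φᵇ zero
    Max-bounded {k = suc k} φ φᵇ = ⊔-bounded {u = ⟦_⟧ N (φ zero)} {⟦_⟧ N (Maxᶠ (φ ∘ suc))}
      (φᵇ zero) (Max-bounded (φ ∘ suc) (φᵇ ∘ suc))

    sup⋆≤0 : ∀ m (φ : Formula L m) → (∀ v → ⟦_⟧ N φ v ≤ 0ℝ) → ∀ v → ⟦_⟧ N (sup⋆ m φ) v ≤ 0ℝ
    sup⋆≤0 zero    φ φ≤0 = φ≤0
    sup⋆≤0 (suc m) φ φ≤0 = sup⋆≤0 m (sup φ) λ v → ⨆≤0 _ λ x → φ≤0 (x ∷ᵛ v)

    module _ (N-bounded : IsBounded N) where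
      open IsBounded N-bounded using (point)

      inf⋆-lower⁻ : ∀ k {m} {φ : Formula L (k ℕ.+ m)} → Bounded (⟦_⟧ N φ) → ∀ y {q} →
        lower (⟦_⟧ N (inf⋆ k φ) y) q → ∀ xs → lower (⟦_⟧ N φ (xs ⊹ y)) q
      inf⋆-lower⁻ zero    φᵇ y l xs = l
      inf⋆-lower⁻ (suc k) {φ = φ} φᵇ y l xs =
        ⨅-lower⁻ (λ x → ⟦_⟧ N φ (x ∷ᵛ (xs ∘ suc) ⊹ y)) point (Bounded-∘ φᵇ (_∷ᵛ (xs ∘ suc) ⊹ y))
          (inf⋆-lower⁻ k {φ = inf φ} (inf-bounded N-bounded {φ = φ} φᵇ) y l (xs ∘ suc)) (xs zero)

      ¬inf⋆-lower : ∀ k {m} {φ : Formula L (k ℕ.+ m)} → Bounded (⟦_⟧ N φ) → ∀ y {q r} → q ℚ.< r →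
        ¬ lower (⟦_⟧ N (inf⋆ k φ) y) q → ∃ λ xs → ¬ lower (⟦_⟧ N φ (xs ⊹ y)) r
      ¬inf⋆-lower zero    {φ = φ} φᵇ y q<r ¬l =
        (λ ()) , ¬l ∘ lower-closed (⟦_⟧ N φ y) (ℚ.<⇒≤ q<r)
      ¬inf⋆-lower (suc k) {φ = φ} φᵇ y q<r ¬l =
        -- Every quantifier uses up a gap, so the given one is divided.
        let p , q<p , p<r = ℚ.<-dense q<r
            xs , ¬l′ = ¬inf⋆-lower k {φ = inf φ} (inf-bounded N-bounded {φ = φ} φᵇ) y q<p ¬l
            x , ¬l″ = ¬⨅-lower (λ x → ⟦_⟧ N φ (x ∷ᵛ xs ⊹ y)) point (Bounded-∘ φᵇ (_∷ᵛ xs ⊹ y)) p<r ¬l′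
        in  x ∷ᵛ xs , ¬l″

  -- Gluing witnesses along a colouring

  module _ {L : Signature s} {I : Set ι} (M : I → Structure L ℓ) (F : Filter I f)
    (splitting : Splitting F) where
    private
      module M i = Structure (M i)
      Mᶠ = reducedProduct M F

    coordinate : ∀ {n} → Vector (∏ M F) n → ∀ i → Vector (M.Carrier i) n
    coordinate v i k = v k i

    Agree-coordinate : ∀ {n} (v : Vector (∏ M F) n) → Agree M F v (coordinate v)
    Agree-coordinate v i k = ≃-refl (M i) (v k i)

    Agree-glue : ∀ {n k m} (c : I → Fin n) (xs : Fin n → Vector (∏ M F) k) (y : Vector (∏ M F) m) →
      Agree M F ((λ l i → xs (c i) l i) ⊹ y) (λ i → coordinate (xs (c i) ⊹ y) i)
    Agree-glue {k = zero}  c xs y i l       = ≃-refl (M i) (y l i)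
    Agree-glue {k = suc k} c xs y i zero    = ≃-refl (M i) (xs (c i) zero i)
    Agree-glue {k = suc k} c xs y i (suc l) = Agree-glue c (λ j → xs j ∘ suc) y i l

    module _ {n k m} {φ : Formula L (k ℕ.+ m)} {ψ : Vector (Formula L (k ℕ.+ m)) (suc n)}
      {D : Vector Unary (suc n)} (φ-palyutin : Palyutin φ) (ψ-palyutin : ∀ j → Palyutin (ψ j))
      (D↘ : ∀ j → Nonincreasing (D j)) (y : Vector (∏ M F) m) where

      glue : ∀ (xs : Fin (suc n) → Vector (∏ M F) k) {q r} → q ℚ.< r →
        (∀ j → ¬ lower (⟦_⟧ Mᶠ φ (xs j ⊹ y)) q) →
        (∀ j → ¬ lower (D j ⟨ ⟦_⟧ Mᶠ (ψ j) (xs j ⊹ y) ⟩) q) →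
        ∃ λ x → ¬ lower (⟦_⟧ Mᶠ φ (x ⊹ y)) r × ∀ j → ¬ lower (D j ⟨ ⟦_⟧ Mᶠ (ψ j) (x ⊹ y) ⟩) r
      glue xs {q} {r} q<r φ≤ Dψ≤ = x , φx≤ , Dψx≤
        where
        -- By continuity `p` lies below the value of `ψ j` yet so near that `D j` is already less
        -- than `r` there; `p′` provides the gap for `IsLimsup.above`.
        threshold : ∀ j → ∃₂ λ p p′ → p ℚ.< p′ ×
          lower (⟦_⟧ Mᶠ (ψ j) (xs j ⊹ y)) p′ × upper (D j ⟨ fromℚ p ⟩) r
        threshold j =
          let Ψ = ⟦_⟧ Mᶠ (ψ j) (xs j ⊹ y)
              p , _ , p∈ , _ , r∈ , _ =
                continuous-upper (D j) Ψ (¬lower⇒upper (D j ⟨ Ψ ⟩) q<r (Dψ≤ j))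
              p′ , p<p′ , p′∈ = lower-rounded Ψ p∈
          in  p , p′ , p<p′ , p′∈ , r∈

        p p′ : Fin (suc n) → ℚ
        p  j = proj₁ (threshold j)
        p′ j = proj₁ (proj₂ (threshold j))

        T : Fin (suc n) → Pred I 0ℓ
        T j i = lower (⟦_⟧ (raw (M i)) (ψ j) (coordinate (xs j ⊹ y) i)) (p′ j)

        coloured : ∃ λ (c : I → Fin (suc n)) → ∀ j → Stationary F (λ i → c i ≡ j × T j i)
        coloured = colouring F splitting T λ j →
          let _ , _ , _ , p′∈ , _ = threshold j
          in  IsLimsup.below
                (palyutin-limsup M F (ψ-palyutin j) (xs j ⊹ y) _ (Agree-coordinate _)) p′∈

        c = proj₁ coloured

        x : Vector (∏ M F) k
        x l i = xs (c i) l i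

        w : ∀ i → Vector (M.Carrier i) (k ℕ.+ m)
        w i = coordinate (xs (c i) ⊹ y) i

        φx≤ : ¬ lower (⟦_⟧ Mᶠ φ (x ⊹ y)) r
        φx≤ l =
          let s = IsLimsup.below (palyutin-limsup M F φ-palyutin (x ⊹ y) w (Agree-glue c xs y)) l
              -- If `φ` were large at the glued point, pigeonhole over the finitely many colours
              -- would make it large at a single `xs j`.
              j , s′ = Stationary-∃ F (λ j i → lower (⟦_⟧ (raw (M i)) φ (coordinate (xs j ⊹ y) i)) r)
                         (Stationary-⊆ F (λ {i} l → c i , l) s)
          in  φ≤ j (IsLimsup.above
                (palyutin-limsup M F φ-palyutin (xs j ⊹ y) _ (Agree-coordinate _)) q<r s′)

        w-∈T : ∀ j i → c i ≡ j × T j i → lower (⟦_⟧ (raw (M i)) (ψ j) (w i)) (p′ j)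
        w-∈T j i (refl , i∈T) = i∈T

        Dψx≤ : ∀ j → ¬ lower (D j ⟨ ⟦_⟧ Mᶠ (ψ j) (x ⊹ y) ⟩) r
        Dψx≤ j l =
          let Ψ = ⟦_⟧ Mᶠ (ψ j) (x ⊹ y)
              _ , _ , p<p′ , _ , r∈ = threshold j
              -- On colour `j` inside `T j` the glued point is `xs j`, so `ψ j` exceeds `p′ j` on a
              -- stationary set and its limit superior exceeds `p j`.
              p∈ = IsLimsup.above
                     (palyutin-limsup M F (ψ-palyutin j) (x ⊹ y) w (Agree-glue c xs y)) p<p′
                     (Stationary-⊆ F (λ {i} → w-∈T j i) (proj₂ coloured j))
          in  upper⇒¬lower (D j ⟨ fromℚ (p j) ⟩) r∈ (D↘ j {fromℚ (p j)} {Ψ} (fromℚ-≤ Ψ p∈) l)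

      private
        Mᶠ-bounded : IsBounded Mᶠ
        Mᶠ-bounded = reducedProduct-bounded M F

        φᵇ : Bounded (⟦_⟧ Mᶠ φ)
        φᵇ = palyutin-bounded Mᶠ-bounded φ-palyutin

        Dψᵇ : ∀ j → Bounded (⟦_⟧ Mᶠ (D j · ψ j))
        Dψᵇ j = anti-bounded {u = ⟦_⟧ Mᶠ (ψ j)} (D j) (D↘ j)
          (palyutin-bounded Mᶠ-bounded (ψ-palyutin j))

        maxᵇ : ∀ j → Bounded (⟦_⟧ Mᶠ (maxᶠ φ (D j · ψ j)))
        maxᵇ j = ⊔-bounded {u = ⟦_⟧ Mᶠ φ} {⟦_⟧ Mᶠ (D j · ψ j)} φᵇ (Dψᵇ j)

        Maxᵇ : Bounded (⟦_⟧ Mᶠ (maxᶠ φ (Maxᶠ λ j → D j · ψ j)))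
        Maxᵇ = ⊔-bounded {u = ⟦_⟧ Mᶠ φ} {⟦_⟧ Mᶠ (Maxᶠ λ j → D j · ψ j)} φᵇ
          (Max-bounded {N = Mᶠ} (λ j → D j · ψ j) Dψᵇ)

      inf-max-≤ : ∀ {r} x → ¬ lower (⟦_⟧ Mᶠ φ (x ⊹ y)) r →
        (∀ j → ¬ lower (D j ⟨ ⟦_⟧ Mᶠ (ψ j) (x ⊹ y) ⟩) r) →
        ¬ lower (⟦_⟧ Mᶠ (inf⋆ k (maxᶠ φ (Maxᶠ λ j → D j · ψ j))) y) r
      inf-max-≤ x φx≤ Dψx≤ l
        with inf⋆-lower⁻ Mᶠ-bounded k {φ = maxᶠ φ (Maxᶠ λ j → D j · ψ j)} Maxᵇ y l x
      ... | inj₁ l′ = φx≤ l′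
      ... | inj₂ l′ = let j , l″ = Max-lower⁻ {N = Mᶠ} (λ j → D j · ψ j) (x ⊹ y) l′ in Dψx≤ j l″

      ¬max-inf-lower : ∀ {q r} → q ℚ.< r →
        ¬ lower (⟦_⟧ Mᶠ (Maxᶠ λ j → inf⋆ k (maxᶠ φ (D j · ψ j))) y) q → ∀ j →
        ∃ λ xs → ¬ lower (⟦_⟧ Mᶠ φ (xs ⊹ y)) r × ¬ lower (D j ⟨ ⟦_⟧ Mᶠ (ψ j) (xs ⊹ y) ⟩) r
      ¬max-inf-lower q<r ¬l j =
        let xs , ¬l′ = ¬inf⋆-lower Mᶠ-bounded k {φ = maxᶠ φ (D j · ψ j)} (maxᵇ j) y q<r
              (λ l → ¬l (Max-lower⁺ {N = Mᶠ} (λ j → inf⋆ k (maxᶠ φ (D j · ψ j))) y j l))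
        in  xs , (λ l → ¬l′ (inj₁ l)) , (λ l → ¬l′ (inj₂ l))

      -- The gap `p < q` pays for near minimisers of the separate infima, `q < r` for gluing them.
      ¬inf-max-lower : ∀ {p q r} → p ℚ.< q → q ℚ.< r →
        ¬ lower (⟦_⟧ Mᶠ (Maxᶠ λ j → inf⋆ k (maxᶠ φ (D j · ψ j))) y) p →
        ¬ lower (⟦_⟧ Mᶠ (inf⋆ k (maxᶠ φ (Maxᶠ λ j → D j · ψ j))) y) r
      ¬inf-max-lower {q = q} {r} p<q q<r ¬l = conclude
        (glue (λ j → proj₁ (xs j)) q<r (λ j → proj₁ (proj₂ (xs j))) (λ j → proj₂ (proj₂ (xs j))))
        where
        xs : ∀ j → ∃ λ x →
          ¬ lower (⟦_⟧ Mᶠ φ (x ⊹ y)) q × ¬ lower (D j ⟨ ⟦_⟧ Mᶠ (ψ j) (x ⊹ y) ⟩) q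
        xs = ¬max-inf-lower p<q ¬l

        conclude : (∃ λ x → ¬ lower (⟦_⟧ Mᶠ φ (x ⊹ y)) r ×
            ∀ j → ¬ lower (D j ⟨ ⟦_⟧ Mᶠ (ψ j) (x ⊹ y) ⟩) r) →
          ¬ lower (⟦_⟧ Mᶠ (inf⋆ k (maxᶠ φ (Maxᶠ λ j → D j · ψ j))) y) r
        conclude (x , φx≤ , Dψx≤) = inf-max-≤ x φx≤ Dψx≤

      inf-max≤max-inf : ⟦_⟧ Mᶠ (inf⋆ k (maxᶠ φ (Maxᶠ λ j → D j · ψ j))) y ≤
        ⟦_⟧ Mᶠ (Maxᶠ λ j → inf⋆ k (maxᶠ φ (D j · ψ j))) y
      inf-max≤max-inf l = stable λ ¬l →
        let r , p<r , r∈ = lower-rounded (⟦_⟧ Mᶠ (inf⋆ k (maxᶠ φ (Maxᶠ λ j → D j · ψ j))) y) l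
            q , p<q , q<r = ℚ.<-dense p<r
        in  ¬inf-max-lower p<q q<r ¬l r∈

    reducedProduct-⊨-SCP : reducedProduct M F ⊨ SCP L
    reducedProduct-⊨-SCP (scp n k m φ ψ D φ-palyutin ψ-palyutin D↘) =
      let lhs = inf⋆ k (maxᶠ φ (Maxᶠ λ j → D j · ψ j))
          rhs = Maxᶠ λ j → inf⋆ k (maxᶠ φ (D j · ψ j))
      in  sup⋆≤0 {N = Mᶠ} m (lhs ⊖ rhs) (λ y → ≤⇒-≤0 (⟦_⟧ Mᶠ lhs y) (⟦_⟧ Mᶠ rhs y)
            (inf-max≤max-inf {φ = φ} {ψ} {D} φ-palyutin ψ-palyutin D↘ y)) []ᵛ

  -- The Fréchet filter

  Cofinite⇒tail : ∀ {X} → X ∈ᴾ Cofinite → ∃ λ n → ∀ m → n ℕ.≤ m → X m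
  Cofinite⇒tail (ns , covers) = suc (maxℕ 0 ns) , λ m max<m → stable λ m∉X →
    ℕ.<⇒≱ max<m (All.lookup (xs≤max 0 ns) (covers m m∉X))

  tail⇒Cofinite : ∀ n {X} → (∀ m → n ℕ.≤ m → X m) → X ∈ᴾ Cofinite
  tail⇒Cofinite n tail = upTo n , λ m m∉X → ∈-upTo⁺ (ℕ.≰⇒> (m∉X ∘ tail m))

  module _ (x : ℕ → Bool) where

    -- Counts modulo 2 the ones of `x` strictly before the argument, so that `alternate` keeps the
    -- second, the fourth, ... of them.
    parity : ℕ → Bool
    parity zero    = false
    parity (suc n) = x n xor parity n

    alternate : ℕ → Bool
    alternate n = x n ∧ parity n

    -- Right after a one of x beyond n the parity differs from b; it changes back only at the next
    -- one, where by hypothesis it would already be b.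
    constant-parity⇒finite : ∀ b {n} → (∀ m → n ℕ.≤ m → x m ≡ true → parity m ≡ b) →
      (λ m → x m ≡ false) ∈ᴾ Cofinite
    constant-parity⇒finite b {n} const with em {P = ∃ λ m → n ℕ.≤ m × x m ≡ true}
    ... | no ¬∃ = tail⇒Cofinite n λ m n≤m → Bool.¬-not λ e → ¬∃ (m , n≤m , e)
    ... | yes (k , n≤k , xk) = tail⇒Cofinite (suc k) λ m k<m → zeros m (ℕ.≤⇒≤′ k<m)
      where
      flips : ∀ {m} → suc k ℕ.≤′ m → parity m ≡ Bool.not b
      zeros : ∀ m → suc k ℕ.≤′ m → x m ≡ false
      flips ℕ.≤′-refl = trans (cong (_xor parity k) xk) (cong Bool.not (const k n≤k xk))
      flips (ℕ.≤′-step {m} k<m) = trans (cong (_xor parity m) (zeros m k<m)) (flips k<m)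
      zeros m k<m = Bool.¬-not λ e → Bool.not-¬ refl
        (trans (sym (const m (ℕ.≤-trans (ℕ.≤-trans n≤k (ℕ.n≤1+n k)) (ℕ.≤′⇒≤ k<m)) e)) (flips k<m))

    alternate-≤ : ∀ n → alternate n ≡ alternate n ∧ x n
    alternate-≤ n with x n | parity n
    ... | false | _     = refl
    ... | true  | false = refl
    ... | true  | true  = refl

  -- An atom `x` would make `alternate x` eventually zero or eventually `x`. Either way the parity
  -- is eventually constant on the ones of `x`, which are then finite in number.
  Fréchet-atomless : Atomless (𝟚^ Fréchet)
  Fréchet-atomless x (x≉⊥ , minimal)
    with minimal (alternate x) (tail⇒Cofinite 0 λ n _ → alternate-≤ x n)
  ... | inj₁ y≈⊥ = let n , tail = Cofinite⇒tail y≈⊥ in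
    x≉⊥ (constant-parity⇒finite x false λ m n≤m e →
      subst (λ b → b ∧ parity x m ≡ false) e (tail m n≤m))
  ... | inj₂ y≈x = let n , tail = Cofinite⇒tail y≈x in
    x≉⊥ (constant-parity⇒finite x true λ m n≤m e →
      subst (λ b → b ∧ parity x m ≡ b) e (tail m n≤m))

lemma3p7 : ∀ {s ℓ ι f} (em : EM) → let open Classical em in
    (L : Signature s) →
    ({I : Set ι} (M : I → Structure L ℓ) (F : Filter I f) →
    Atomless (𝟚^ F) → reducedProduct M F ⊨ SCP L)
    × ((M : ℕ → Structure L ℓ) → reducedProduct M Fréchet ⊨ SCP L)
lemma3p7 em L =
  (λ M F atomless → reducedProduct-⊨-SCP em M F (atomless⇒splitting em F atomless)) ,
  (λ M → reducedProduct-⊨-SCP em M Fréchet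
    (atomless⇒splitting em Fréchet (Fréchet-atomless em)))
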